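{- The problem Short Path Packing can be solved in $(k\cdot \ell^2)^{k\cdot \ell}\cdot O(n+m)$ time (by a search-tree algorithm, after transforming the input into an instance of the problem Short Path Packing with Checkpoints), where $n=|V(G)|$ and $m=|E(G)|$ for the input graph $G$. That is, there is an algorithm which, given a graph $G$, two vertices $s,t\in V(G)$ and two integers $k,\ell\in\mathbb{N}$, correctly decides within this running time whether there exist $k$ internally vertex-disjoint $s$-$t$ paths in $G$, each of length at most $\ell$.
   Context: Graphs are finite, undirected, simple and unweighted. $\mathbb{N}$ is the set of natural numbers starting at 1, and $[i]=\{1,\dots,i\}$. A path is a non-empty sequence of distinct, consecutively adjacent vertices; its length is its number of vertices minus one. An $s$-$t$ path is a path whose first vertex is $s$ and whose last vertex is $t$. A collection of $s$-$t$ paths $(P_i)_{i\in[k]}$ is internally vertex-disjoint if $V(P_i)\cap V(P_j)=\{s,t\}$ for all $i\ne j$. Short Path Packing: Instance: a graph $G$, two vertices $s,t\in V(G)$, integers $k,\ell\in\mathbb{N}$. Question: are there $k$ internally vertex-disjoint $s$-$t$ paths in $G$, each of length at most $\ell$? Short Path Packing with Checkpoints: Instance: additionally $k$ terminal lists $L_1,\dots,L_k$ of vertices, each having first element $s$ and last element $t$. Question: are there $k$ internally vertex-disjoint $s$-$t$ paths $P_1,\dots,P_k$ in $G$, each of length at most $\ell$, such that each $P_i$ starts in the first element of $L_i$, visits the further elements of $L_i$ in the order of the list, and ends in the last element of $L_i$? An instance of Short Path Packing is turned into one of this problem by setting $L_i=(s,t)$ for all $i\in[k]$. -}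

module Defs where

open import Data.Fin using (Fin; toℕ)
open import Data.List using (List; []; _∷_; length; map)
open import Data.List.Membership.Propositional using (_∈_)
import Data.List.NonEmpty as List⁺
open List⁺ using (List⁺)
open import Data.List.Relation.Unary.All using (All)
open import Data.List.Relation.Unary.AllPairs using (AllPairs)
open import Data.List.Relation.Unary.Linked using (Linked)
open import Data.List.Relation.Unary.Unique.Propositional using (Unique)
open import Data.Nat using (ℕ; zero; suc; _+_; _∸_; _≤_; _≡ᵇ_)
open import Data.Bool using (if_then_else_)
open import Data.Product using (Σ-syntax; _×_; _,_; proj₁; proj₂; swap)
open import Data.Sum using (_⊎_)
open import Function.Bundles using (_⇔_)
open import Relation.Binary.PropositionalEquality using (_≡_; _≢_)
open import Relation.Nullary using (¬_)

-- The edge set is a list of unordered pairs: every edge occurs exactly once,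
-- in one of its two orientations.
record Graph : Set where
  field
    n        : ℕ
    edges    : List (Fin n × Fin n)
    loopless : All (λ e → proj₁ e ≢ proj₂ e) edges
    simple   : AllPairs (λ e f → e ≢ f × e ≢ swap f) edges

  Vertex : Set
  Vertex = Fin n

  m : ℕ
  m = length edges

  _~_ : Vertex → Vertex → Set
  u ~ v = (u , v) ∈ edges ⊎ (v , u) ∈ edges

module _ (G : Graph) where
  open Graph G

  record IsPath (s t : Vertex) (P : List⁺ Vertex) : Set where
    field
      distinct : Unique (List⁺.toList P)
      adjacent : Linked _~_ (List⁺.toList P)
      first    : List⁺.head P ≡ s
      last     : List⁺.last P ≡ t

  pathLength : List⁺ Vertex → ℕ
  pathLength P = List⁺.length P ∸ 1

  _∈V_ : Vertex → List⁺ Vertex → Set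
  v ∈V P = v ∈ List⁺.toList P

  -- V(Pᵢ) ∩ V(Pⱼ) = {s , t} for all i ≠ j.  The collection is an indexed family.
  InternallyVertexDisjoint : (s t : Vertex) {k : ℕ} → (Fin k → List⁺ Vertex) → Set
  InternallyVertexDisjoint s t P =
    ∀ i j → i ≢ j → ∀ v → (v ∈V P i × v ∈V P j) ⇔ (v ≡ s ⊎ v ≡ t)

  ShortPathPacking : (s t : Vertex) (k ℓ : ℕ) → Set
  ShortPathPacking s t k ℓ =
    Σ[ P ∈ (Fin k → List⁺ Vertex) ]
      (∀ i → IsPath s t (P i))
      × InternallyVertexDisjoint s t P
      × (∀ i → pathLength (P i) ≤ ℓ)

-- Model of computation: structured programs for a unit-cost RAM whose only
-- arithmetic is addition and truncated subtraction (no multiplication).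
-- A program is a fixed finite text, so it names only finitely many registers
-- `var x` and finitely many arrays `a [ _ ]`; an array name is part of the text
-- and only the index is computed.  Interleaving the arrays in a single memory
-- changes running times by a constant factor only.

Var Arr : Set
Var = ℕ
Arr = ℕ

infixl 6 _⊕_ _⊖_
data Expr : Set where
  lit     : ℕ → Expr
  var     : Var → Expr
  _[_]    : Arr → Expr → Expr
  _⊕_ _⊖_ : Expr → Expr → Expr

infix  4 _≔_ _[_]≔_ IF_THEN_ELSE_ WHILE_DO_
infixr 3 _⨾_
data Program : Set where
  skip          : Program
  _≔_           : Var → Expr → Program
  _[_]≔_        : Arr → Expr → Expr → Program
  _⨾_           : Program → Program → Program
  IF_THEN_ELSE_ : Expr → Program → Program → Program
  WHILE_DO_     : Expr → Program → Program

record State : Set where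
  constructor state
  field
    regs   : Var → ℕ
    arrays : Arr → ℕ → ℕ

open State public

_[_↦_] : {A : Set} → (ℕ → A) → ℕ → A → (ℕ → A)
(f [ x ↦ a ]) y = if x ≡ᵇ y then a else f y

⟦_⟧ : Expr → State → ℕ
⟦ lit i ⟧   σ = i
⟦ var x ⟧   σ = regs σ x
⟦ a [ e ] ⟧ σ = arrays σ a (⟦ e ⟧ σ)
⟦ e ⊕ f ⟧   σ = ⟦ e ⟧ σ + ⟦ f ⟧ σ
⟦ e ⊖ f ⟧   σ = ⟦ e ⟧ σ ∸ ⟦ f ⟧ σ

-- Evaluating an expression costs one time unit per operation in it.
cost : Expr → ℕ
cost (lit i)   = 1
cost (var x)   = 1
cost (a [ e ]) = 1 + cost e
cost (e ⊕ f)   = 1 + cost e + cost f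
cost (e ⊖ f)   = 1 + cost e + cost f

-- ⟨ p , σ ⟩⇓⟨ σ′ , T ⟩: started in σ, p halts in σ′ after exactly T time units.
-- A condition counts as true iff it is non-zero.
infix 2 ⟨_,_⟩⇓⟨_,_⟩
data ⟨_,_⟩⇓⟨_,_⟩ : Program → State → State → ℕ → Set where

  ⇓skip : ∀ {σ} → ⟨ skip , σ ⟩⇓⟨ σ , 1 ⟩

  ⇓assign : ∀ {σ x e} →
    ⟨ x ≔ e , σ ⟩⇓⟨ state (regs σ [ x ↦ ⟦ e ⟧ σ ]) (arrays σ) , 1 + cost e ⟩

  ⇓store : ∀ {σ a e f} →
    ⟨ a [ e ]≔ f , σ ⟩⇓⟨ state (regs σ)
                          (arrays σ [ a ↦ arrays σ a [ ⟦ e ⟧ σ ↦ ⟦ f ⟧ σ ] ])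
                      , 1 + cost e + cost f ⟩

  ⇓seq : ∀ {p q σ σ′ σ″ T U} →
    ⟨ p , σ ⟩⇓⟨ σ′ , T ⟩ → ⟨ q , σ′ ⟩⇓⟨ σ″ , U ⟩ →
    ⟨ p ⨾ q , σ ⟩⇓⟨ σ″ , T + U ⟩

  ⇓if-true : ∀ {e p q σ σ′ T} → ⟦ e ⟧ σ ≢ 0 →
    ⟨ p , σ ⟩⇓⟨ σ′ , T ⟩ →
    ⟨ IF e THEN p ELSE q , σ ⟩⇓⟨ σ′ , 1 + cost e + T ⟩

  ⇓if-false : ∀ {e p q σ σ′ T} → ⟦ e ⟧ σ ≡ 0 →
    ⟨ q , σ ⟩⇓⟨ σ′ , T ⟩ →
    ⟨ IF e THEN p ELSE q , σ ⟩⇓⟨ σ′ , 1 + cost e + T ⟩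

  ⇓while-true : ∀ {e p σ σ′ σ″ T U} → ⟦ e ⟧ σ ≢ 0 →
    ⟨ p , σ ⟩⇓⟨ σ′ , T ⟩ → ⟨ WHILE e DO p , σ′ ⟩⇓⟨ σ″ , U ⟩ →
    ⟨ WHILE e DO p , σ ⟩⇓⟨ σ″ , 1 + cost e + T + U ⟩

  ⇓while-false : ∀ {e p σ} → ⟦ e ⟧ σ ≡ 0 →
    ⟨ WHILE e DO p , σ ⟩⇓⟨ σ , 1 + cost e ⟩

-- Cells beyond the given values are 0.
cells : List ℕ → ℕ → ℕ
cells []       _       = 0
cells (x ∷ xs) zero    = x
cells (x ∷ xs) (suc i) = cells xs i

-- Input: registers 0 … 5 hold n, m, s, t, k, ℓ; arrays 0 and 1 hold the first
-- and second endpoints of the m edges, with vertices numbered 0 … n - 1.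
input : (G : Graph) (s t : Graph.Vertex G) (k ℓ : ℕ) → State
input G s t k ℓ = state (cells (n ∷ m ∷ toℕ s ∷ toℕ t ∷ k ∷ ℓ ∷ [])) edgeArrays
  where
  open Graph G
  edgeArrays : Arr → ℕ → ℕ
  edgeArrays 0 = cells (map (λ e → toℕ (proj₁ e)) edges)
  edgeArrays 1 = cells (map (λ e → toℕ (proj₂ e)) edges)
  edgeArrays _ = cells []

-- Output: register 0 holds 1 for "yes" and 0 for "no".
Answers : State → Set → Set
Answers σ Q = (regs σ 0 ≡ 1 × Q) ⊎ (regs σ 0 ≡ 0 × ¬ Q)

{-# OPTIONS --safe #-}

-- Colour the vertices: colour j + 1 reserves a vertex for path j, colour 0 leaves
-- it open.  The paths are found one after the other.  While path c is sought, let
-- Q be a path of length at most ℓ from s to t whose inner vertices are open or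
-- reserved for c (found by Bellman-Ford).  If a solution respects the colouring,
-- then either no other path of it meets Q in an inner vertex, and path c of the
-- solution may be replaced by Q, or some inner vertex w of Q lies on another path j,
-- is still open, and may be reserved for j.  Either choice decreases the number of
-- unfinished paths plus the number of open inner vertices on the solution, which is
-- at most k * ℓ initially.  So k * ℓ steps suffice, each with one of at most
-- 1 + (ℓ − 1) * k ≤ k * ℓ choices, and the program tries all sequences of choices.
-- Each attempt takes time O(k * ℓ * k * ℓ * (n + m)), and (k * ℓ)² ≤ 3 * ℓ ^ (k * ℓ)
-- if ℓ ≥ 2; for ℓ = 1 there is only one sequence.
module Submission where

open import Defs
open import Data.Bool using (Bool; true; false; T; not; _∨_)
open import Data.Fin using (Fin; toℕ; fromℕ<)
open import Data.Fin.Properties using (toℕ-fromℕ<; toℕ<n; toℕ-injective)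
import Data.Fin.Properties as Fin
open import Data.List using (List; []; _∷_; length; map; lookup; allFin; initLast; _∷ʳ′_)
open import Data.List.Membership.Propositional using (_∈_; find)
open import Data.List.Membership.Propositional.Properties using (∈-allFin; ∈-lookup)
import Data.List.NonEmpty as List⁺
open List⁺ using (List⁺)
open import Data.List.Properties using (length-tabulate)
open import Data.List.Relation.Unary.All using (All; []; _∷_)
import Data.List.Relation.Unary.All as All
open import Data.List.Relation.Unary.AllPairs using ([]; _∷_)
open import Data.List.Relation.Unary.Any using (here; there)
import Data.List.Relation.Unary.Any as Any
open import Data.List.Relation.Unary.Linked using (Linked; [-]; _∷_)
open import Data.List.Relation.Unary.Unique.Propositional using (Unique)
open import Data.Nat
open import Data.Nat.ListAction using (sum)
open import Data.Nat.Properties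
open import Data.Nat.Solver using (module +-*-Solver)
open import Data.Product using (Σ-syntax; ∃; _×_; _,_; proj₁; proj₂)
open import Data.Sum using (_⊎_; inj₁; inj₂; swap)
open import Data.Unit using (⊤; tt)
open import Function using (_∘_; case_of_)
open import Function.Bundles using (Equivalence; mk⇔)
open import Relation.Binary.PropositionalEquality hiding ([_])
open import Relation.Nullary using (¬_; Dec; contradiction; yes; no; ¬?; _×-dec_)

-- Counting loops: denotation, running time and dependence on the state

-- The program has neither recursion nor multiplication, so a branch of the search tree is a number
-- with `k * ℓ` digits in base `B = 1 + (ℓ ∸ 1) * k`, and one loop counts through all these codes.
-- Soundness holds for every code. Completeness concerns a single code, and this code must be
-- planned: the right digit depends on the path that the search returns, hence on all earlier
-- digits. It is planned along a reference run into which each digit is written directly. `AgreeOff`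
-- then carries the outcome over to the actual run, which reads the digits from its code and differs
-- from the reference run in the answer, the code and the code counter. All loops are counted, with
-- limits read from registers that no longer change. Termination and a running time bound can
-- therefore be read off the program text, and only products of loop limits remain to be estimated.

infix  4 _←_ _[_]←_ If_Then_Else_ For_To_Do_
infixr 3 _▸_
data Loop : Set where
  pass          : Loop
  _←_           : Var → Expr → Loop
  _[_]←_        : Arr → Expr → Expr → Loop
  _▸_           : Loop → Loop → Loop
  If_Then_Else_ : Expr → Loop → Loop → Loop
  For_To_Do_    : Var → Var → Loop → Loop

-- The counter runs downwards, so that a zero test ends the loop.
compile : Loop → Program
compile pass                 = skip
compile (x ← e)              = x ≔ e
compile (a [ e ]← f)         = a [ e ]≔ f
compile (p ▸ q)              = compile p ⨾ compile q
compile (If e Then p Else q) = IF e THEN compile p ELSE compile q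
compile (For r To x Do p)    =
  r ≔ var x ⨾ WHILE var r DO (r ≔ var r ⊖ lit 1 ⨾ compile p)

setReg : Var → ℕ → State → State
setReg r v σ = state (regs σ [ r ↦ v ]) (arrays σ)

choose : {A : Set} → ℕ → A → A → A
choose zero    x y = y
choose (suc _) x y = x

countdown : (ℕ → State → State) → ℕ → State → State
countdown h zero    σ = σ
countdown h (suc i) σ = countdown h i (h i σ)

⟪_⟫ : Loop → State → State
⟪ pass ⟫ σ                 = σ
⟪ x ← e ⟫ σ                = setReg x (⟦ e ⟧ σ) σ
⟪ a [ e ]← f ⟫ σ           =
  state (regs σ) (arrays σ [ a ↦ arrays σ a [ ⟦ e ⟧ σ ↦ ⟦ f ⟧ σ ] ])
⟪ p ▸ q ⟫ σ                = ⟪ q ⟫ (⟪ p ⟫ σ)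
⟪ If e Then p Else q ⟫ σ   = choose (⟦ e ⟧ σ) (⟪ p ⟫ σ) (⟪ q ⟫ σ)
⟪ For r To x Do p ⟫ σ      =
  countdown (λ i τ → ⟪ p ⟫ (setReg r i τ)) (regs σ x) (setReg r (regs σ x) σ)

-- A conditional is charged for both branches, which keeps the bound free of the state. In a loop, 4
-- pays for setting the counter and for the last, failing test; each 6 pays for a test and a
-- decrement.
time : (Var → ℕ) → Loop → ℕ
time ρ pass                 = 1
time ρ (x ← e)              = 1 + cost e
time ρ (a [ e ]← f)         = 1 + cost e + cost f
time ρ (p ▸ q)              = time ρ p + time ρ q
time ρ (If e Then p Else q) = 1 + cost e + (time ρ p + time ρ q)
time ρ (For r To x Do p)    = 4 + ρ x * (6 + time ρ p)

Keeps : (Var → Bool) → Loop → Set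
Keeps L pass                 = ⊤
Keeps L (x ← e)              = T (not (L x))
Keeps L (a [ e ]← f)         = ⊤
Keeps L (p ▸ q)              = Keeps L p × Keeps L q
Keeps L (If e Then p Else q) = Keeps L p × Keeps L q
Keeps L (For r To x Do p)    = T (not (L r)) × Keeps L p

KeepsArr : (Arr → Bool) → Loop → Set
KeepsArr A pass                 = ⊤
KeepsArr A (x ← e)              = ⊤
KeepsArr A (a [ e ]← f)         = T (not (A a))
KeepsArr A (p ▸ q)              = KeepsArr A p × KeepsArr A q
KeepsArr A (If e Then p Else q) = KeepsArr A p × KeepsArr A q
KeepsArr A (For r To x Do p)    = KeepsArr A p

-- Loop limits come from registers in `L`, which are never written, so bounds `ρ` that hold at the
-- start hold whenever a loop is entered. A body that leaves its own counter alone makes the `WHILE`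
-- follow `countdown`.
Bounded : (Var → Bool) → Loop → Set
Bounded L pass                 = ⊤
Bounded L (x ← e)              = T (not (L x))
Bounded L (a [ e ]← f)         = ⊤
Bounded L (p ▸ q)              = Bounded L p × Bounded L q
Bounded L (If e Then p Else q) = Bounded L p × Bounded L q
Bounded L (For r To x Do p)    = T (L x) × T (not (L r)) × Keeps (r ≡ᵇ_) p × Bounded L p

only : ℕ → ℕ → Bool
only r = r ≡ᵇ_

T-not⇒≡false : ∀ {b} → T (not b) → b ≡ false
T-not⇒≡false {false} _ = refl

T⇒≡true : ∀ {b} → T b → b ≡ true
T⇒≡true {true} _ = refl

≡ᵇ-refl : ∀ x → (x ≡ᵇ x) ≡ true
≡ᵇ-refl x = T⇒≡true (≡⇒≡ᵇ x x refl)

≡ᵇ-≢ : ∀ {x y} → x ≢ y → (x ≡ᵇ y) ≡ false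
≡ᵇ-≢ {x} {y} x≢y with x ≡ᵇ y in eq
... | false = refl
... | true  = contradiction (≡ᵇ⇒≡ x y (subst T (sym eq) tt)) x≢y

update-same : {A : Set} (f : ℕ → A) (x : ℕ) (v : A) → (f [ x ↦ v ]) x ≡ v
update-same f x v rewrite ≡ᵇ-refl x = refl

update-other : {A : Set} (f : ℕ → A) {x y : ℕ} (v : A) → x ≢ y → (f [ x ↦ v ]) y ≡ f y
update-other f v x≢y rewrite ≡ᵇ-≢ x≢y = refl

separated : (L : ℕ → Bool) {x y : ℕ} → T (not (L x)) → T (L y) → x ≢ y
separated L ¬Lx Ly refl with trans (sym (T⇒≡true Ly)) (T-not⇒≡false ¬Lx)
... | ()

countdown-preserves : (I : State → Set) (h : ℕ → State → State) →
  (∀ i σ → I σ → I (h i σ)) → ∀ i σ → I σ → I (countdown h i σ)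
countdown-preserves I h step zero    σ Iσ = Iσ
countdown-preserves I h step (suc i) σ Iσ =
  countdown-preserves I h step i (h i σ) (step i σ Iσ)

countdown-invariant : (I : ℕ → State → Set) (h : ℕ → State → State) (l : ℕ) →
  (∀ i σ → i < l → I (suc i) σ → I i (h i σ)) →
  ∀ σ → I l σ → I 0 (countdown h l σ)
countdown-invariant I h l step = go l ≤-refl
  where
  go : ∀ i → i ≤ l → ∀ σ → I i σ → I 0 (countdown h i σ)
  go zero    _   σ Iσ = Iσ
  go (suc i) i<l σ Iσ = go i (<⇒≤ i<l) (h i σ) (step i σ i<l Iσ)

choose-preserves : {A : Set} (I : A → Set) (c : ℕ) {x y : A} → I x → I y → I (choose c x y)
choose-preserves I zero    Ix Iy = Iy
choose-preserves I (suc _) Ix Iy = Ix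

if-true : ∀ e p q σ → ⟦ e ⟧ σ ≢ 0 → ⟪ If e Then p Else q ⟫ σ ≡ ⟪ p ⟫ σ
if-true e p q σ ≢0 with ⟦ e ⟧ σ
... | zero  = contradiction refl ≢0
... | suc _ = refl

if-false : ∀ e p q σ → ⟦ e ⟧ σ ≡ 0 → ⟪ If e Then p Else q ⟫ σ ≡ ⟪ q ⟫ σ
if-false e p q σ ≡0 rewrite ≡0 = refl

keeps : (L : Var → Bool) {y : Var} → T (L y) → ∀ p → Keeps L p → ∀ σ →
  regs (⟪ p ⟫ σ) y ≡ regs σ y
keeps L Ly pass                 K         σ = refl
keeps L Ly (x ← e)              K         σ = update-other (regs σ) _ (separated L K Ly)
keeps L Ly (a [ e ]← f)         K         σ = refl
keeps L Ly (p ▸ q)              (Kp , Kq) σ =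
  trans (keeps L Ly q Kq (⟪ p ⟫ σ)) (keeps L Ly p Kp σ)
keeps L Ly (If e Then p Else q) (Kp , Kq) σ =
  choose-preserves (λ τ → regs τ _ ≡ regs σ _) (⟦ e ⟧ σ) (keeps L Ly p Kp σ) (keeps L Ly q Kq σ)
keeps L Ly (For r To x Do p)    (Kr , Kp) σ =
  countdown-preserves (λ τ → regs τ _ ≡ regs σ _) _
    (λ i τ eq → trans (keeps L Ly p Kp (setReg r i τ))
                      (trans (update-other (regs τ) i (separated L Kr Ly)) eq))
    (regs σ x) _ (update-other (regs σ) _ (separated L Kr Ly))

keepsArr : (A : Arr → Bool) {b : Arr} → T (A b) → ∀ p → KeepsArr A p → ∀ σ →
  arrays (⟪ p ⟫ σ) b ≡ arrays σ b
keepsArr A Ab pass                 K         σ = refl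
keepsArr A Ab (x ← e)              K         σ = refl
keepsArr A Ab (a [ e ]← f)         K         σ = update-other (arrays σ) _ (separated A K Ab)
keepsArr A Ab (p ▸ q)              (Kp , Kq) σ =
  trans (keepsArr A Ab q Kq (⟪ p ⟫ σ)) (keepsArr A Ab p Kp σ)
keepsArr A Ab (If e Then p Else q) (Kp , Kq) σ =
  choose-preserves (λ τ → arrays τ _ ≡ arrays σ _) (⟦ e ⟧ σ)
    (keepsArr A Ab p Kp σ) (keepsArr A Ab q Kq σ)
keepsArr A Ab (For r To x Do p)    Kp        σ =
  countdown-preserves (λ τ → arrays τ _ ≡ arrays σ _) _
    (λ i τ eq → trans (keepsArr A Ab p Kp (setReg r i τ)) eq)
    (regs σ x) _ refl

bounded⇒keeps : (L : Var → Bool) → ∀ p → Bounded L p → Keeps L p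
bounded⇒keeps L pass                 B                 = tt
bounded⇒keeps L (x ← e)              B                 = B
bounded⇒keeps L (a [ e ]← f)         B                 = tt
bounded⇒keeps L (p ▸ q)              (Bp , Bq)         =
  bounded⇒keeps L p Bp , bounded⇒keeps L q Bq
bounded⇒keeps L (If e Then p Else q) (Bp , Bq)         =
  bounded⇒keeps L p Bp , bounded⇒keeps L q Bq
bounded⇒keeps L (For r To x Do p)    (_ , Lr , _ , Bp) = Lr , bounded⇒keeps L p Bp

-- Execution of compiled loops within their time bounds

record Runs (p : Program) (σ τ : State) (b : ℕ) : Set where
  constructor runs
  field
    {elapsed} : ℕ
    run       : ⟨ p , σ ⟩⇓⟨ τ , elapsed ⟩
    inTime    : elapsed ≤ b

runs-seq : ∀ {p q σ τ υ b c} → Runs p σ τ b → Runs q τ υ c → Runs (p ⨾ q) σ υ (b + c)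
runs-seq (runs r₁ t₁) (runs r₂ t₂) = runs (⇓seq r₁ r₂) (+-mono-≤ t₁ t₂)

module Execution (L : Var → Bool) (ρ : Var → ℕ) where

  WithinLimits : State → Set
  WithinLimits σ = ∀ x → T (L x) → regs σ x ≤ ρ x

  stillWithin : ∀ p → Keeps L p → ∀ σ → WithinLimits σ → WithinLimits (⟪ p ⟫ σ)
  stillWithin p K σ lim x Lx = subst (_≤ ρ x) (sym (keeps L Lx p K σ)) (lim x Lx)

  within-setReg : ∀ {r} v σ → T (not (L r)) → WithinLimits σ → WithinLimits (setReg r v σ)
  within-setReg v σ Lr lim x Lx =
    subst (_≤ ρ x) (sym (update-other (regs σ) v (separated L Lr Lx))) (lim x Lx)

  exec : ∀ p → Bounded L p → ∀ σ → WithinLimits σ → Runs (compile p) σ (⟪ p ⟫ σ) (time ρ p)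
  exec pass B σ lim = runs ⇓skip ≤-refl
  exec (x ← e) B σ lim = runs ⇓assign ≤-refl
  exec (a [ e ]← f) B σ lim = runs ⇓store ≤-refl
  exec (p ▸ q) (Bp , Bq) σ lim = runs-seq (exec p Bp σ lim)
    (exec q Bq (⟪ p ⟫ σ) (stillWithin p (bounded⇒keeps L p Bp) σ lim))
  exec (If e Then p Else q) (Bp , Bq) σ lim with ⟦ e ⟧ σ in eq
  ... | zero = let runs r t = exec q Bq σ lim in
    runs (⇓if-false eq r) (+-monoʳ-≤ (1 + cost e) (≤-trans t (m≤n+m _ _)))
  ... | suc _ = let runs r t = exec p Bp σ lim in
    runs (⇓if-true (λ ≡0 → contradiction (trans (sym eq) ≡0) λ ()) r)
         (+-monoʳ-≤ (1 + cost e) (≤-trans t (m≤m+n _ _)))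
  exec (For r To x Do p) (Lx , Lr , Kp , Bp) σ lim =
    let runs w t = loop (regs σ x) (setReg r (regs σ x) σ)
                     (within-setReg _ σ Lr lim) (update-same (regs σ) r _)
    in runs (⇓seq ⇓assign w)
         (+-monoʳ-≤ 2 (≤-trans t (+-monoʳ-≤ 2 (*-monoˡ-≤ (6 + time ρ p) (lim x Lx)))))
    where
    loop : ∀ i τ → WithinLimits τ → regs τ r ≡ i →
      Runs (WHILE var r DO (r ≔ var r ⊖ lit 1 ⨾ compile p)) τ
           (countdown (λ j υ → ⟪ p ⟫ (setReg r j υ)) i τ) (2 + i * (6 + time ρ p))
    loop zero    τ lim eq = runs (⇓while-false eq) ≤-refl
    loop (suc i) τ lim eq =
      let lim′ = within-setReg i τ Lr lim
          runs b tb = exec p Bp (setReg r i τ) lim′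
          runs w tw = loop i (⟪ p ⟫ (setReg r i τ))
                        (stillWithin p (bounded⇒keeps L p Bp) _ lim′)
                        (trans (keeps (r ≡ᵇ_) (≡⇒≡ᵇ r r refl) p Kp _) (update-same (regs τ) r i))
          d = subst (λ v → ⟨ r ≔ var r ⊖ lit 1 , τ ⟩⇓⟨ setReg r v τ , 4 ⟩)
                (cong pred eq) ⇓assign
      in runs (⇓while-true (λ ≡0 → contradiction (trans (sym eq) ≡0) λ ()) (⇓seq d b) w)
           (≤-trans (+-mono-≤ (+-monoʳ-≤ 6 tb) tw)
             (≤-reflexive (trans (sym (+-assoc (6 + time ρ p) 2 _))
                (trans (cong (_+ i * (6 + time ρ p)) (+-comm (6 + time ρ p) 2))
                       (+-assoc 2 (6 + time ρ p) _)))))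

-- Runs from states that differ in a few registers

Ignores : (Var → Bool) → Expr → Set
Ignores X (lit i)   = ⊤
Ignores X (var x)   = T (not (X x))
Ignores X (a [ e ]) = Ignores X e
Ignores X (e ⊕ f)   = Ignores X e × Ignores X f
Ignores X (e ⊖ f)   = Ignores X e × Ignores X f

Unaware : (Var → Bool) → Loop → Set
Unaware X pass                 = ⊤
Unaware X (x ← e)              = Ignores X e
Unaware X (a [ e ]← f)         = Ignores X e × Ignores X f
Unaware X (p ▸ q)              = Unaware X p × Unaware X q
Unaware X (If e Then p Else q) = Ignores X e × Unaware X p × Unaware X q
Unaware X (For r To x Do p)    = T (not (X x)) × Unaware X p

-- Only registers may differ. Arrays have to agree at every index, since an index is computed and
-- any cell may be read.
record AgreeOff (X : Var → Bool) (σ τ : State) : Set where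
  constructor agree
  field
    regsAgree   : ∀ r → T (not (X r)) → regs σ r ≡ regs τ r
    arraysAgree : ∀ a y → arrays σ a y ≡ arrays τ a y

open AgreeOff

update-cong : {A : Set} (f g : ℕ → A) {v w : A} (x y : ℕ) → v ≡ w → f y ≡ g y →
  (f [ x ↦ v ]) y ≡ (g [ x ↦ w ]) y
update-cong f g x y v≡w fy≡gy with x ≡ᵇ y
... | true  = v≡w
... | false = fy≡gy

ignores : ∀ {X σ τ} → AgreeOff X σ τ → ∀ e → Ignores X e → ⟦ e ⟧ σ ≡ ⟦ e ⟧ τ
ignores A (lit i)   I         = refl
ignores A (var x)   I         = regsAgree A x I
ignores {τ = τ} A (a [ e ]) I =
  trans (arraysAgree A a _) (cong (arrays τ a) (ignores A e I))
ignores A (e ⊕ f)   (I , J) = cong₂ _+_ (ignores A e I) (ignores A f J)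
ignores A (e ⊖ f)   (I , J) = cong₂ _∸_ (ignores A e I) (ignores A f J)

agree-setReg : ∀ {X σ τ} r {v w} → v ≡ w → AgreeOff X σ τ →
  AgreeOff X (setReg r v σ) (setReg r w τ)
agree-setReg {σ = σ} {τ} r v≡w A =
  agree (λ y Xy → update-cong (regs σ) (regs τ) r y v≡w (regsAgree A y Xy)) (arraysAgree A)

unaware : ∀ {X} p → Unaware X p → ∀ {σ τ} → AgreeOff X σ τ →
  AgreeOff X (⟪ p ⟫ σ) (⟪ p ⟫ τ)
unaware pass U A = A
unaware (x ← e) U A = agree-setReg x (ignores A e U) A
unaware {X} (a [ e ]← f) (Ue , Uf) {σ} {τ} A = agree (regsAgree A) cell
  where
  cell : ∀ b y → arrays (⟪ a [ e ]← f ⟫ σ) b y ≡ arrays (⟪ a [ e ]← f ⟫ τ) b y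
  cell b y with a ≡ᵇ b
  ... | false = arraysAgree A b y
  ... | true rewrite ignores A e Ue =
    update-cong (arrays σ a) (arrays τ a) (⟦ e ⟧ τ) y (ignores A f Uf) (arraysAgree A a y)
unaware (p ▸ q) (Up , Uq) A = unaware q Uq (unaware p Up A)
unaware (If e Then p Else q) (Ue , Up , Uq) {σ} {τ} A
  rewrite ignores A e Ue with ⟦ e ⟧ τ
... | zero  = unaware q Uq A
... | suc _ = unaware p Up A
unaware {X} (For r To x Do p) (Ux , Up) {σ} {τ} A
  rewrite regsAgree A x Ux = go (regs τ x) (agree-setReg r refl A)
  where
  go : ∀ i {σ τ} → AgreeOff X σ τ →
    AgreeOff X (countdown (λ j υ → ⟪ p ⟫ (setReg r j υ)) i σ)
               (countdown (λ j υ → ⟪ p ⟫ (setReg r j υ)) i τ)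
  go zero    A = A
  go (suc i) A = go i (unaware p Up (agree-setReg r refl A))

-- Bellman-Ford search from t

nR mR sR tR kR ℓR stepsR digitsR codesR curR : Var
nR = 0
mR = 1
sR = 2
tR = 3
kR = 4
ℓR = 5
stepsR = 6
digitsR = 7
codesR = 8
curR = 9

-- codeR encodes the choices still to be made, in base digitsR.
ansR codeR gR finR uR vR wR : Var
ansR = 10
codeR = 11
gR = 12
finR = 13
uR = 14
vR = 15
wR = 16

codeC clearC stepC edgeC roundC digitC traceC : Var
codeC = 17
clearC = 18
stepC = 19
edgeC = 20
roundC = 21
digitC = 22
traceC = 23

sumR setupC powerC : Var
sumR = 24
setupC = 25
powerC = 26

tailA headA powA colA potA parA : Arr
tailA = 0
headA = 1
powA = 2
colA = 3
potA = 4
parA = 5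

-- With truncated subtraction this is the absolute difference, so as a condition it tests for
-- inequality.
differ : Expr → Expr → Expr
differ e f = (e ⊖ f) ⊕ (f ⊖ e)

distance-refl : ∀ {a b} → a ≡ b → (a ∸ b) + (b ∸ a) ≡ 0
distance-refl {a} refl = cong₂ _+_ (n∸n≡0 a) (n∸n≡0 a)

distance-≢0 : ∀ {a b} → a ≢ b → (a ∸ b) + (b ∸ a) ≢ 0
distance-≢0 {a} {b} a≢b ≡0 = a≢b (≤-antisym
  (m∸n≡0⇒m≤n (m+n≡0⇒m≡0 (a ∸ b) ≡0)) (m∸n≡0⇒m≤n (m+n≡0⇒n≡0 (a ∸ b) ≡0)))

pred-< : ∀ {a b} → a < b ∸ 1 → b ∸ 1 < b
pred-< {b = suc b} _ = ≤-refl

clear : Arr → Loop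
clear a = For clearC To nR Do (a [ var clearC ]← lit 0)

-- A sum of two zero-one tests serves as a disjunction: the vertex is open, or it has the colour
-- `curR + 1` of the path being sought.
allowed : Expr
allowed = (lit 1 ⊖ (colA [ var vR ])) ⊕ (lit 1 ⊖ differ (colA [ var vR ]) (var curR ⊕ lit 1))

-- A strict gain implies that `u` has positive potential, so the value stored for `v` lies below the
-- potential of its new parent.
update : Loop
update =
  If allowed Then
    (If ((potA [ var uR ]) ⊖ lit 1) ⊖ (potA [ var vR ]) Then
       ((potA [ var vR ]← (potA [ var uR ]) ⊖ lit 1) ▸ (parA [ var vR ]← var uR))
     Else pass)
  Else pass

relax : Arr → Arr → Loop
relax a b = (uR ← a [ var edgeC ]) ▸ (vR ← b [ var edgeC ]) ▸ update

relaxAll : Loop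
relaxAll = For edgeC To mR Do (relax tailA headA ▸ relax headA tailA)

search : Loop
search = clear potA ▸ (potA [ var tR ]← var ℓR ⊕ lit 1) ▸ (For roundC To ℓR Do relaxAll)

clear-spec : ∀ a σ n → regs σ nR ≡ n →
  (∀ y → y < n → arrays (⟪ clear a ⟫ σ) a y ≡ 0) ×
  (∀ y → n ≤ y → arrays (⟪ clear a ⟫ σ) a y ≡ arrays σ a y)
clear-spec a σ n refl =
  (λ y y<n → proj₁ final y z≤n y<n) , proj₂ final
  where
  I : ℕ → State → Set
  I i τ = (∀ y → i ≤ y → y < n → arrays τ a y ≡ 0) × (∀ y → n ≤ y → arrays τ a y ≡ arrays σ a y)

  step : ∀ i τ → i < n → I (suc i) τ → I i (⟪ a [ var clearC ]← lit 0 ⟫ (setReg clearC i τ))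
  step i τ i<n (low , high) rewrite ≡ᵇ-refl a = low′ , high′
    where
    low′ : ∀ y → i ≤ y → y < n → (arrays τ a [ i ↦ 0 ]) y ≡ 0
    low′ y i≤y y<n with i ≟ y
    ... | yes refl = update-same (arrays τ a) i 0
    ... | no  i≢y  = trans (update-other (arrays τ a) 0 i≢y) (low y (≤∧≢⇒< i≤y i≢y) y<n)
    high′ : ∀ y → n ≤ y → (arrays τ a [ i ↦ 0 ]) y ≡ arrays σ a y
    high′ y n≤y = trans (update-other (arrays τ a) 0 (<⇒≢ (<-≤-trans i<n n≤y))) (high y n≤y)

  final : I 0 (⟪ clear a ⟫ σ)
  final = countdown-invariant I _ n step _
    ((λ y n≤y y<n → contradiction y<n (≤⇒≯ n≤y)) , λ _ _ → refl)

cells-map : {A : Set} (h : A → ℕ) (xs : List A) {i : ℕ} (i<l : i < length xs) →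
  cells (map h xs) i ≡ h (lookup xs (fromℕ< i<l))
cells-map h (x ∷ xs) {zero}  (s≤s z≤n) = refl
cells-map h (x ∷ xs) {suc i} (s≤s i<l) = cells-map h xs i<l

-- Registers and arrays are numbered with the more permanent ones first, so that initial segments of
-- various lengths describe what a piece of the program preserves.
record Matches (r b : ℕ) (ρ : Var → ℕ) (α : Arr → ℕ → ℕ) (σ : State) : Set where
  constructor matches
  field
    regsMatch   : ∀ x → T (x <ᵇ r) → regs σ x ≡ ρ x
    arraysMatch : ∀ a → T (a <ᵇ b) → ∀ y → arrays σ a y ≡ α a y

open Matches

matches-kept : ∀ {r b ρ α} p → Keeps (_<ᵇ r) p → KeepsArr (_<ᵇ b) p → ∀ {σ} →
  Matches r b ρ α σ → Matches r b ρ α (⟪ p ⟫ σ)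
matches-kept {r} {b} p K KA {σ} M = matches
  (λ x Lx → trans (keeps (_<ᵇ r) Lx p K σ) (regsMatch M x Lx))
  (λ a Aa y → trans (cong-app (keepsArr (_<ᵇ b) Aa p KA σ) y) (arraysMatch M a Aa y))

matches-setReg : ∀ {r b ρ α σ} x v → T (not (x <ᵇ r)) →
  Matches r b ρ α σ → Matches r b ρ α (setReg x v σ)
matches-setReg {r} {σ = σ} x v xr M = matches
  (λ y Ly → trans (update-other (regs σ) v (separated (_<ᵇ r) xr Ly)) (regsMatch M y Ly))
  (arraysMatch M)

-- `N`, `B`, `M` stand for the number of steps, the base and the number of codes, and `pw` for the
-- table of powers of `B`. They stay variables until `Solving` fixes the three numbers.
module Instance (G : Graph) (s t : Graph.Vertex G) (k ℓ N B M : ℕ) (pw : ℕ → ℕ) where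
  open Graph G

  ρ₀ : ℕ → Var → ℕ
  ρ₀ c = cells (n ∷ m ∷ toℕ s ∷ toℕ t ∷ k ∷ ℓ ∷ N ∷ B ∷ M ∷ c ∷ [])

  α₀ : (ℕ → ℕ) → Arr → ℕ → ℕ
  α₀ col 0 = cells (map (λ e → toℕ (proj₁ e)) edges)
  α₀ col 1 = cells (map (λ e → toℕ (proj₂ e)) edges)
  α₀ col 2 = pw
  α₀ col _ = col

  ~-sym : ∀ {u v} → u ~ v → v ~ u
  ~-sym = swap

  module Searching (c : ℕ) (col : ℕ → ℕ) where

    Context : State → Set
    Context = Matches 10 4 (ρ₀ c) (α₀ col)

    Allowed : Vertex → Set
    Allowed v = col (toℕ v) ≡ 0 ⊎ col (toℕ v) ≡ suc c

    -- pot v is ℓ + 1 minus the length of a walk from t to v, and 0 if v is unreached.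
    record Potential (pot par : ℕ → ℕ) : Set where
      field
        source : pot (toℕ t) ≡ suc ℓ
        capped : ∀ (v : Vertex) → pot (toℕ v) ≤ suc ℓ
        parent : ∀ (v : Vertex) → pot (toℕ v) ≢ 0 → v ≡ t ⊎
          Σ[ u ∈ Vertex ] (par (toℕ v) ≡ toℕ u × v ~ u × Allowed v × pot (toℕ v) < pot (toℕ u))
        unused : ∀ y → n ≤ y → pot y ≡ 0 × par y ≡ 0

    open Potential public

    -- No potential decreases, so the parent condition of the other vertices survives even if their
    -- parent is `v`.
    potential-update : ∀ {pot par i j} u v → i ≡ toℕ v → j ≡ toℕ u → v ~ u → Allowed v →
      Potential pot par → pot i < pot j ∸ 1 →
      Potential (pot [ i ↦ pot j ∸ 1 ]) (par [ i ↦ j ])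
    potential-update {pot} {par} u v refl refl v~u Av P lt = record
      { source = trans (update-other pot _ (v≢t ∘ toℕ-injective)) (source P)
      ; capped = capped′ ; parent = parent′ ; unused = unused′ }
      where
      f = pot (toℕ u) ∸ 1
      f≤ℓ : f ≤ ℓ
      f≤ℓ = ∸-monoˡ-≤ 1 (capped P u)
      -- `t` holds the cap `ℓ + 1` and a new value is at most `ℓ`, so `t` is never updated.
      v≢t : v ≢ t
      v≢t refl = contradiction (≤-trans lt f≤ℓ) (<⇒≱ (<-trans (n<1+n ℓ) (≤-reflexive (cong suc (sym (source P))))))
      f<pot-u : f < pot (toℕ u)
      f<pot-u = pred-< {b = pot (toℕ u)} lt
      grows : ∀ y → pot y ≤ (pot [ toℕ v ↦ f ]) y
      grows y with toℕ v ≟ y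
      ... | yes refl = ≤-trans (<⇒≤ lt) (≤-reflexive (sym (update-same pot _ f)))
      ... | no  v≢y  = ≤-reflexive (sym (update-other pot f v≢y))
      capped′ : ∀ (w : Vertex) → (pot [ toℕ v ↦ f ]) (toℕ w) ≤ suc ℓ
      capped′ w with toℕ v ≟ toℕ w
      ... | yes eq rewrite sym eq = ≤-trans (≤-reflexive (update-same pot _ f)) (m≤n⇒m≤1+n f≤ℓ)
      ... | no  neq = ≤-trans (≤-reflexive (update-other pot f neq)) (capped P w)
      unused′ : ∀ y → n ≤ y → (pot [ toℕ v ↦ f ]) y ≡ 0 × (par [ toℕ v ↦ toℕ u ]) y ≡ 0
      unused′ y n≤y = trans (update-other pot f v≢y) (proj₁ (unused P y n≤y)) ,
                      trans (update-other par _ v≢y) (proj₂ (unused P y n≤y))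
        where v≢y = <⇒≢ (<-≤-trans (toℕ<n v) n≤y)
      parent′ : ∀ (w : Vertex) → (pot [ toℕ v ↦ f ]) (toℕ w) ≢ 0 → w ≡ t ⊎
        Σ[ x ∈ Vertex ] ((par [ toℕ v ↦ toℕ u ]) (toℕ w) ≡ toℕ x × w ~ x × Allowed w ×
          (pot [ toℕ v ↦ f ]) (toℕ w) < (pot [ toℕ v ↦ f ]) (toℕ x))
      parent′ w ≢0 with v Fin.≟ w
      ... | yes refl = inj₂ (u , update-same par _ _ , v~u , Av ,
        ≤-trans (≤-reflexive (cong suc (update-same pot _ f))) (≤-trans f<pot-u (grows _)))
      ... | no v≢w with parent P w (λ ≡0 → ≢0 (trans (update-other pot f (v≢w ∘ toℕ-injective)) ≡0))
      ...   | inj₁ w≡t = inj₁ w≡t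
      ...   | inj₂ (x , eq , w~x , Aw , lt′) = inj₂ (x ,
        trans (update-other par _ (v≢w ∘ toℕ-injective)) eq , w~x , Aw ,
        ≤-trans (≤-reflexive (cong suc (update-other pot f (v≢w ∘ toℕ-injective))))
                (≤-trans lt′ (grows _)))

    pot : State → Vertex → ℕ
    pot σ v = arrays σ potA (toℕ v)

    Valid : State → Set
    Valid σ = Potential (arrays σ potA) (arrays σ parA)

    allowed-true : ∀ {σ v} → Context σ → regs σ vR ≡ toℕ v → Allowed v → ⟦ allowed ⟧ σ ≢ 0
    allowed-true {σ} {v} C eq A ≡0 rewrite arraysMatch C colA tt (regs σ vR) | regsMatch C curR tt | eq
      with A
    ... | inj₁ col≡0 rewrite col≡0 = 1+n≢0 ≡0
    ... | inj₂ col≡c rewrite col≡c =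
      1+n≢0 (trans (cong (1 ∸_) (sym (distance-refl (+-comm 1 c)))) (m+n≡0⇒n≡0 (1 ∸ suc c) ≡0))

    allowed-only : ∀ {σ v} → Context σ → regs σ vR ≡ toℕ v → ⟦ allowed ⟧ σ ≢ 0 → Allowed v
    allowed-only {σ} {v} C eq ≢0 rewrite arraysMatch C colA tt (regs σ vR) | regsMatch C curR tt | eq
      with col (toℕ v) ≟ 0 | col (toℕ v) ≟ suc c
    ... | yes a | _     = inj₁ a
    ... | _     | yes b = inj₂ b
    ... | no a  | no b  = contradiction
      (cong₂ _+_ (m≤n⇒m∸n≡0 (n≢0⇒n>0 a))
                 (m≤n⇒m∸n≡0 (n≢0⇒n>0 (distance-≢0 (λ e → b (trans e (+-comm c 1))))))) ≢0

    record Relaxed (σ τ : State) (u v : Vertex) : Set where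
      field
        context  : Context τ
        valid    : Valid τ
        improved : ∀ w → pot σ w ≤ pot τ w
        settled  : Allowed v → pot σ u ∸ 1 ≤ pot τ v

    update-spec : ∀ σ u v → Context σ → Valid σ → regs σ uR ≡ toℕ u → regs σ vR ≡ toℕ v → v ~ u →
      Relaxed σ (⟪ update ⟫ σ) u v
    update-spec σ u v C P equ eqv v~u = record
      { context = matches-kept update _ _ C ; valid = proj₁ main
      ; improved = proj₁ (proj₂ main) ; settled = proj₂ (proj₂ main) }
      where
      inner : Loop
      inner = (potA [ var vR ]← (potA [ var uR ]) ⊖ lit 1) ▸ (parA [ var vR ]← var uR)
      test : Expr
      test = ((potA [ var uR ]) ⊖ lit 1) ⊖ (potA [ var vR ])
      Goal : State → Set
      Goal τ = Valid τ × (∀ w → pot σ w ≤ pot τ w) × (Allowed v → pot σ u ∸ 1 ≤ pot τ v)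
      grow : ∀ f i y → arrays σ potA i ≤ f → arrays σ potA y ≤ (arrays σ potA [ i ↦ f ]) y
      grow f i y le with i ≟ y
      ... | yes refl = ≤-trans le (≤-reflexive (sym (update-same (arrays σ potA) i f)))
      ... | no  i≢y  = ≤-reflexive (sym (update-other (arrays σ potA) f i≢y))
      main : Goal (⟪ update ⟫ σ)
      main with ⟦ allowed ⟧ σ ≟ 0
      ... | yes ≡0 rewrite ≡0 = P , (λ _ → ≤-refl) , λ A → contradiction ≡0 (allowed-true C eqv A)
      ... | no ≢0 rewrite if-true allowed (If test Then inner Else pass) pass σ ≢0
        with ⟦ test ⟧ σ ≟ 0
      ...   | yes ≡0 rewrite ≡0 = P , (λ _ → ≤-refl) , λ A →
        subst₂ (λ i j → arrays σ potA i ∸ 1 ≤ arrays σ potA j) equ eqv (m∸n≡0⇒m≤n ≡0)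
      ...   | no test≢0 rewrite if-true test inner pass σ test≢0 =
        potential-update u v eqv equ v~u (allowed-only C eqv ≢0) P lt ,
        (λ w → grow _ _ (toℕ w) (<⇒≤ lt)) ,
        λ _ → ≤-reflexive (trans (cong (λ i → arrays σ potA i ∸ 1) (sym equ))
                (sym (subst (λ i → (arrays σ potA [ i ↦ new ]) (toℕ v) ≡ new) (sym eqv)
                        (update-same (arrays σ potA) (toℕ v) new))))
        where
        new = arrays σ potA (regs σ uR) ∸ 1
        lt : arrays σ potA (regs σ vR) < arrays σ potA (regs σ uR) ∸ 1
        lt = m∸n≢0⇒n<m test≢0

    relax-spec : ∀ a b σ u v → Context σ → Valid σ →
      ⟦ a [ var edgeC ] ⟧ σ ≡ toℕ u → ⟦ b [ var edgeC ] ⟧ σ ≡ toℕ v → v ~ u →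
      Relaxed σ (⟪ relax a b ⟫ σ) u v
    relax-spec a b σ u v C P equ eqv v~u =
      record { Relaxed r }
      where
      r = update-spec (⟪ (uR ← a [ var edgeC ]) ▸ (vR ← b [ var edgeC ]) ⟫ σ) u v
            (matches-setReg vR _ _ (matches-setReg uR _ _ C)) P equ eqv v~u

    -- The guarantee refers to the potentials before the round; improvements during the round only
    -- help, because potentials never decrease. Every edge is relaxed in both directions, as it is
    -- stored in one orientation only.
    relaxAll-spec : ∀ σ → Context σ → Valid σ →
      Context (⟪ relaxAll ⟫ σ) × Valid (⟪ relaxAll ⟫ σ) ×
      (∀ w → pot σ w ≤ pot (⟪ relaxAll ⟫ σ) w) ×
      (∀ u v → u ~ v → Allowed v → pot σ u ∸ 1 ≤ pot (⟪ relaxAll ⟫ σ) v)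
    relaxAll-spec σ C P rewrite regsMatch C mR tt =
      let (C′ , P′ , mono , done) = final in C′ , P′ , mono , λ
        { u v (inj₁ uv) → proj₁ (done (Any.index uv) z≤n u v (sym (lookup-index uv)))
        ; u v (inj₂ vu) → proj₂ (done (Any.index vu) z≤n v u (sym (lookup-index vu))) }
      where
      lookup-index : ∀ {e} {es : List (Vertex × Vertex)} (e∈ : e ∈ es) → e ≡ lookup es (Any.index e∈)
      lookup-index (here refl) = refl
      lookup-index (there e∈) = lookup-index e∈
      Done : State → Fin m → Set
      Done τ j = ∀ u v → lookup edges j ≡ (u , v) →
        (Allowed v → pot σ u ∸ 1 ≤ pot τ v) × (Allowed u → pot σ v ∸ 1 ≤ pot τ u)
      I : ℕ → State → Set
      I i τ = Context τ × Valid τ × (∀ w → pot σ w ≤ pot τ w) × (∀ j → i ≤ toℕ j → Done τ j)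
      step : ∀ i τ → i < m → I (suc i) τ →
        I i (⟪ relax tailA headA ▸ relax headA tailA ⟫ (setReg edgeC i τ))
      step i τ i<m (C , P , mono , done) =
        R₂.context , R₂.valid ,
        (λ w → ≤-trans (mono w) (≤-trans (R₁.improved w) (R₂.improved w))) , done′
        where
        j₀ = fromℕ< i<m
        u₀ = proj₁ (lookup edges j₀)
        v₀ = proj₂ (lookup edges j₀)
        C₀ = matches-setReg {σ = τ} edgeC i tt C
        u₀~v₀ : u₀ ~ v₀
        u₀~v₀ = inj₁ (∈-lookup j₀)
        r₁ = relax-spec tailA headA (setReg edgeC i τ) u₀ v₀ C₀ P
               (trans (arraysMatch C tailA tt i) (cells-map _ edges i<m))
               (trans (arraysMatch C headA tt i) (cells-map _ edges i<m)) (~-sym {u₀} {v₀} u₀~v₀)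
        module R₁ = Relaxed r₁
        τ₁ = ⟪ relax tailA headA ⟫ (setReg edgeC i τ)
        edgeC-kept : regs τ₁ edgeC ≡ i
        edgeC-kept = keeps (only edgeC) {edgeC} tt (relax tailA headA) _ (setReg edgeC i τ)
        r₂ = relax-spec headA tailA τ₁ v₀ u₀ R₁.context R₁.valid
               (trans (arraysMatch R₁.context headA tt _) (trans (cong (α₀ col 1) edgeC-kept) (cells-map _ edges i<m)))
               (trans (arraysMatch R₁.context tailA tt _) (trans (cong (α₀ col 0) edgeC-kept) (cells-map _ edges i<m)))
               u₀~v₀
        module R₂ = Relaxed r₂
        done′ : ∀ j → i ≤ toℕ j → Done (⟪ relax headA tailA ⟫ τ₁) j
        done′ j i≤j u v eq with i ≟ toℕ j
        ... | no i≢j = let (d₁ , d₂) = done j (≤∧≢⇒< i≤j i≢j) u v eq in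
          (λ A → ≤-trans (d₁ A) (≤-trans (R₁.improved v) (R₂.improved v))) ,
          (λ A → ≤-trans (d₂ A) (≤-trans (R₁.improved u) (R₂.improved u)))
        ... | yes i≡j with toℕ-injective {i = j₀} {j = j} (trans (toℕ-fromℕ< i<m) i≡j)
        ...   | refl with eq
        ...     | refl =
          (λ A → ≤-trans (∸-monoˡ-≤ 1 (mono u₀)) (≤-trans (R₁.settled A) (R₂.improved v₀))) ,
          (λ A → ≤-trans (∸-monoˡ-≤ 1 (≤-trans (mono v₀) (R₁.improved v₀))) (R₂.settled A))
      final : I 0 (countdown (λ i τ → ⟪ relax tailA headA ▸ relax headA tailA ⟫ (setReg edgeC i τ)) m (setReg edgeC m σ))
      final = countdown-invariant I _ m step (setReg edgeC m σ)
        (matches-setReg edgeC m tt C , P , (λ _ → ≤-refl) ,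
         λ j m≤j → contradiction (toℕ<n j) (≤⇒≯ m≤j))

    data Walk : ℕ → Vertex → Set where
      start  : Walk 0 t
      extend : ∀ {d u v} → Walk d u → u ~ v → Allowed v → Walk (suc d) v

    -- With `i` rounds to go, a walk of length `d ≤ ℓ ∸ i` forces a potential of at least
    -- `ℓ + 1 ∸ d` at its end; each round extends this by one edge. After the last round a walk of
    -- length at most `ℓ` to `s` leaves a positive potential there.
    search-spec : ∀ σ → Context σ → (∀ y → n ≤ y → arrays σ potA y ≡ 0 × arrays σ parA y ≡ 0) →
      Context (⟪ search ⟫ σ) × Valid (⟪ search ⟫ σ) ×
      (∀ {d} → d ≤ ℓ → Walk d s → pot (⟪ search ⟫ σ) s ≢ 0)
    search-spec σ C zeros = let (C′ , P′ , reach) = final in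
      C′ , P′ , λ {d} d≤ℓ w ≡0 →
        <⇒≱ (s≤s d≤ℓ) (m∸n≡0⇒m≤n {suc ℓ} {d} (n≤0⇒n≡0 (subst (_ ≤_) ≡0 (reach d s w (≤-trans (≤-reflexive (+-identityʳ d)) d≤ℓ)))))
      where
      σ₁ = ⟪ clear potA ⟫ σ
      C₁ = matches-kept (clear potA) _ _ C
      σ₂ = ⟪ potA [ var tR ]← var ℓR ⊕ lit 1 ⟫ σ₁
      C₂ : Context σ₂
      C₂ = matches-kept (potA [ var tR ]← var ℓR ⊕ lit 1) _ _ C₁
      cs = clear-spec potA σ n (regsMatch C nR tt)
      all-zero : ∀ y → arrays σ₁ potA y ≡ 0
      all-zero y with y <? n
      ... | yes y<n = proj₁ cs y y<n
      ... | no  y≮n = trans (proj₂ cs y (≮⇒≥ y≮n)) (proj₁ (zeros y (≮⇒≥ y≮n)))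
      pot-t : arrays σ₂ potA (toℕ t) ≡ suc ℓ
      pot-t rewrite regsMatch C₁ tR tt | regsMatch C₁ ℓR tt =
        trans (update-same (arrays σ₁ potA) (toℕ t) _) (+-comm ℓ 1)
      pot-other : ∀ y → toℕ t ≢ y → arrays σ₂ potA y ≡ 0
      pot-other y t≢y rewrite regsMatch C₁ tR tt = trans (update-other (arrays σ₁ potA) _ t≢y) (all-zero y)
      P₂ : Valid σ₂
      P₂ = record
        { source = pot-t
        ; capped = λ v → capped′ v
        ; parent = λ v ≢0 → parent′ v ≢0
        ; unused = λ y n≤y → pot-other y (<⇒≢ (<-≤-trans (toℕ<n t) n≤y)) ,
            trans (cong-app (keepsArr (only parA) {parA} tt (clear potA) _ σ) y) (proj₂ (zeros y n≤y)) }
        where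
        capped′ : ∀ (v : Vertex) → arrays σ₂ potA (toℕ v) ≤ suc ℓ
        capped′ v with toℕ t ≟ toℕ v
        ... | yes eq = ≤-reflexive (trans (cong (arrays σ₂ potA) (sym eq)) pot-t)
        ... | no neq = subst (_≤ suc ℓ) (sym (pot-other _ neq)) z≤n
        parent′ : ∀ (v : Vertex) → arrays σ₂ potA (toℕ v) ≢ 0 → v ≡ t ⊎ _
        parent′ v ≢0 with toℕ t ≟ toℕ v
        ... | yes eq = inj₁ (toℕ-injective (sym eq))
        ... | no neq = contradiction (pot-other _ neq) ≢0
      I : ℕ → State → Set
      I i τ = Context τ × Valid τ × (∀ d v → Walk d v → d + i ≤ ℓ → suc ℓ ∸ d ≤ pot τ v)
      round : ∀ i τ → i < ℓ → I (suc i) τ → I i (⟪ relaxAll ⟫ (setReg roundC i τ))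
      round i τ i<ℓ (C , P , reach) = C′ , P′ , reach′
        where
        r = relaxAll-spec (setReg roundC i τ) (matches-setReg roundC i tt C) P
        C′ = proj₁ r
        P′ = proj₁ (proj₂ r)
        reach′ : ∀ d v → Walk d v → d + i ≤ ℓ → suc ℓ ∸ d ≤ pot (⟪ relaxAll ⟫ (setReg roundC i τ)) v
        reach′ zero    v start le = ≤-reflexive (sym (source P′))
        reach′ (suc d) v (extend {u = u} w u~v A) le = ≤-trans
          (≤-trans (≤-reflexive (trans (cong (suc ℓ ∸_) (+-comm 1 d)) (sym (∸-+-assoc (suc ℓ) d 1))))
                   (∸-monoˡ-≤ 1 (reach d u w (≤-trans (≤-reflexive (+-suc d i)) le))))
          (proj₂ (proj₂ (proj₂ r)) u v u~v A)
      final : I 0 (⟪ For roundC To ℓR Do relaxAll ⟫ σ₂)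
      final = subst (λ l → I 0 (countdown _ l (setReg roundC l σ₂))) (sym (regsMatch C₂ ℓR tt))
        (countdown-invariant I _ ℓ round (setReg roundC ℓ σ₂)
          (matches-setReg roundC ℓ tt C₂ , P₂ ,
           λ { zero v start _ → ≤-reflexive (sym pot-t)
             ; (suc d) v w le → contradiction (≤-trans (s≤s (m≤n+m ℓ d)) le) 1+n≰n }))

-- Tracing the path found and colouring its vertices

-- Subtracting `k` at every inner vertex divides the digit by `k` along the way. While `gR` exceeds
-- `k` the vertex is passed over; the remainder, between 1 and `k`, is at once the signal to paint
-- and the colour to use.
mark : Loop
mark =
  If var finR Then (colA [ var wR ]← var curR ⊕ lit 1)
  Else
    ((If var gR Then (If var gR ⊖ var kR Then pass Else (colA [ var wR ]← var gR)) Else pass)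
     ▸ (gR ← var gR ⊖ var kR))

markInner : Loop
markInner = If differ (var wR) (var tR) Then mark Else pass

-- The surrounding loop always makes `ℓ` rounds, so it has to idle once a shorter path has arrived
-- at `t`.
follow : Loop
follow =
  If differ (var wR) (var tR) Then ((wR ← parA [ var wR ]) ▸ markInner) Else pass

-- Division by repeated subtraction. The counter `stepC` runs down, so the leading digit is taken
-- first and the code left over belongs to the remaining steps. Adding 1 before the subtraction
-- turns the test into `codeR ≥ B ^ stepC`.
extract : Loop
extract =
  (gR ← lit 0) ▸
  (For digitC To digitsR Do
    (If (var codeR ⊕ lit 1) ⊖ (powA [ var stepC ]) Then
       ((codeR ← var codeR ⊖ (powA [ var stepC ])) ▸ (gR ← var gR ⊕ lit 1))
     Else pass))

-- The digit 0 finishes the current path with the vertices found; the digit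
-- 1 + p * k + j gives the p-th of these vertices to path j.
react : Loop
react =
  (finR ← lit 1 ⊖ var gR) ▸ (wR ← var sR) ▸ (For traceC To ℓR Do follow) ▸
  (curR ← var curR ⊕ var finR)

reactIfReached : Loop
reactIfReached = If potA [ var sR ] Then react Else pass

-- Once all `k` paths are finished nothing changes any more, so a success is never lost. A search
-- that misses `s` leaves the colours and the current path as they are.
oneStep : Loop
oneStep = If var kR ⊖ var curR Then (search ▸ extract ▸ reactIfReached) Else pass

next-digit : ∀ k p j → suc (k + p * k + j) ∸ k ≡ suc (p * k + j)
next-digit k p j =
  trans (cong (_∸ k) (trans (cong suc (+-assoc k (p * k) j)) (sym (+-suc k (p * k + j)))))
        (m+n∸m≡n k _)

module Tracing (G : Graph) (s t : Graph.Vertex G) (k ℓ N B M : ℕ) (pw : ℕ → ℕ) where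
  open Graph G
  open Instance G s t k ℓ N B M pw

  -- The list omits the first vertex. These are walks; the distinctness required of the paths in the
  -- answer is supplied by the search, whose potentials increase strictly along parents.
  data Chain : Vertex → List Vertex → Set where
    end : Chain t []
    _∷_ : ∀ {v w ws} → v ~ w → Chain w ws → Chain v (w ∷ ws)

  module _ (par : ℕ → ℕ) where

    data Traced : Vertex → List Vertex → Set where
      end  : Traced t []
      next : ∀ {v w ws} → v ≢ t → par (toℕ v) ≡ toℕ w → v ~ w → Traced w ws → Traced v (w ∷ ws)

    traced⇒chain : ∀ {v ws} → Traced v ws → Chain v ws
    traced⇒chain end              = end
    traced⇒chain (next _ _ v~w T) = v~w ∷ traced⇒chain T

    traced-t : ∀ {ws} → Traced t ws → ws ≡ []
    traced-t end              = refl
    traced-t (next t≢t _ _ _) = contradiction refl t≢t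

  module Following (c : ℕ) where

    -- The effect of `mark`, and below of the whole tracing loop, as a map of colourings. The
    -- argument about solutions can then be made without states.
    paint : ℕ → ℕ → ℕ → (ℕ → ℕ) → ℕ → ℕ
    paint fin g i col =
      choose fin (col [ i ↦ c + 1 ]) (choose g (choose (g ∸ k) col (col [ i ↦ g ])) col)

    paintAll : ℕ → ℕ → List Vertex → (ℕ → ℕ) → ℕ → ℕ
    paintAll fin g []       col = col
    paintAll fin g (w ∷ ws) col with w Fin.≟ t
    ... | yes _ = col
    ... | no  _ = paintAll fin (choose fin g (g ∸ k)) ws (paint fin g (toℕ w) col)

    paint-other : ∀ fin g {i y} col → i ≢ y → paint fin g i col y ≡ col y
    paint-other (suc _) g       col i≢y = update-other col _ i≢y
    paint-other zero    zero    col i≢y = refl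
    paint-other zero    (suc g) col i≢y with suc g ∸ k
    ... | zero  = update-other col _ i≢y
    ... | suc _ = refl

    paintAll-other : ∀ fin g ws col y → (∀ x → x ∈ ws → x ≢ t → toℕ x ≢ y) →
      paintAll fin g ws col y ≡ col y
    paintAll-other fin g []       col y out = refl
    paintAll-other fin g (w ∷ ws) col y out with w Fin.≟ t
    ... | yes _   = refl
    ... | no  w≢t = trans
      (paintAll-other fin _ ws _ y (λ x x∈ → out x (there x∈)))
      (paint-other fin g col (out w (here refl) w≢t))

    paintAll-finish : ∀ fin g {par v ws} col → Traced par v ws → ∀ {x} → x ∈ ws → x ≢ t →
      paintAll (suc fin) g ws col (toℕ x) ≡ suc c
    paintAll-finish fin g col (next {w = w} _ _ _ T) x∈ x≢t with w Fin.≟ t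
    paintAll-finish fin g col (next _ _ _ T) (here refl) x≢t | yes w≡t = contradiction w≡t x≢t
    paintAll-finish fin g col (next _ _ _ T) (there x∈) x≢t | yes refl with traced-t _ T
    paintAll-finish fin g col (next _ _ _ T) (there ()) x≢t | yes refl | refl
    paintAll-finish fin g col (next _ _ _ T) (there x∈) x≢t | no _ = paintAll-finish fin g _ T x∈ x≢t
    paintAll-finish fin g {ws = w ∷ ws} col (next _ _ _ T) (here refl) x≢t | no _
      with Any.any? (w Fin.≟_) ws
    -- A later occurrence of `w` is painted with the same colour.
    ... | yes w∈ = paintAll-finish fin g _ T w∈ x≢t
    ... | no w∉  = trans
      (paintAll-other (suc fin) g ws _ (toℕ w) (λ x x∈ _ eq → w∉ (subst (_∈ ws) (toℕ-injective eq) x∈)))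
      (trans (update-same col (toℕ w) _) (+-comm c 1))

    paintAll-idle : ∀ ws col y → paintAll 0 0 ws col y ≡ col y
    paintAll-idle []       col y = refl
    paintAll-idle (w ∷ ws) col y with w Fin.≟ t
    ... | yes _ = refl
    ... | no  _ = subst (λ g → paintAll 0 g ws col y ≡ col y) (sym (0∸n≡0 k)) (paintAll-idle ws col y)

    -- The digit arrives at `x` reduced to `1 + j`. Vertices before `x` see a digit above `k` and
    -- those after it see 0, so only the colour of `x` changes.
    paintAll-branch : ∀ {par v ws x} col (T : Traced par v ws) (x∈ : x ∈ ws) → x ≢ t → ∀ {j} → j < k →
      let col′ = paintAll 0 (suc (toℕ (Any.index x∈) * k + j)) ws col in
      col′ (toℕ x) ≡ suc j × (∀ y → toℕ x ≢ y → col′ y ≡ col y)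
    paintAll-branch {x = x} col (next {w = w} {ws} _ _ _ T) (here refl) x≢t {j} j<k
      with w Fin.≟ t
    ... | yes w≡t = contradiction w≡t x≢t
    ... | no _ rewrite m≤n⇒m∸n≡0 j<k =
      trans (paintAll-idle ws _ (toℕ x)) (update-same col (toℕ x) (suc j)) ,
      λ y x≢y → trans (paintAll-idle ws _ y) (update-other col (suc j) x≢y)
    paintAll-branch {x = x} col (next {w = w} {ws} _ _ _ T) (there x∈) x≢t {j} j<k
      with w Fin.≟ t
    ... | yes refl with traced-t _ T
    paintAll-branch {x = x} col (next {w = w} {ws} _ _ _ T) (there ()) x≢t {j} j<k | yes refl | refl
    paintAll-branch {x = x} col (next {w = w} {ws} _ _ _ T) (there x∈) x≢t {j} j<k | no _
      rewrite next-digit k (toℕ (Any.index x∈)) j = paintAll-branch col T x∈ x≢t j<k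

    -- Tracing changes the colours, so only the three arrays before `colA` are fixed, and the
    -- colouring passed to `α₀` is arbitrary.
    Ready : State → Set
    Ready = Matches 10 3 (ρ₀ c) (α₀ (λ _ → 0))

    mark-spec : ∀ σ → Ready σ →
      arrays (⟪ mark ⟫ σ) colA ≡ paint (regs σ finR) (regs σ gR) (regs σ wR) (arrays σ colA) ×
      regs (⟪ mark ⟫ σ) gR ≡ choose (regs σ finR) (regs σ gR) (regs σ gR ∸ k)
    mark-spec σ R with regs σ finR
    ... | suc _ = cong (λ x → arrays σ colA [ regs σ wR ↦ x + 1 ]) (regsMatch R curR tt) , refl
    ... | zero with regs σ gR in eqg
    ...   | zero  = refl , cong₂ _∸_ eqg (regsMatch R kR tt)
    ...   | suc g with suc g ∸ regs σ kR in eqk | regsMatch R kR tt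
    ...     | zero | refl rewrite eqk = refl , trans (cong (_∸ regs σ kR) eqg) eqk
    ...     | suc _ | refl rewrite eqk = refl , trans (cong (_∸ regs σ kR) eqg) eqk

    differ-t : ∀ {σ v} → Ready σ → regs σ wR ≡ toℕ v → v ≢ t → ⟦ differ (var wR) (var tR) ⟧ σ ≢ 0
    differ-t R eq v≢t = distance-≢0
      (λ w≡t → v≢t (toℕ-injective (trans (sym eq) (trans w≡t (regsMatch R tR tt)))))

    equal-t : ∀ {σ} → Ready σ → regs σ wR ≡ toℕ t → ⟦ differ (var wR) (var tR) ⟧ σ ≡ 0
    equal-t R eq = distance-refl (trans eq (sym (regsMatch R tR tt)))

    followStep : ℕ → State → State
    followStep i τ = ⟪ follow ⟫ (setReg traceC i τ)

    following-done : ∀ i τ → Ready τ → regs τ wR ≡ toℕ t →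
      arrays (countdown followStep i τ) colA ≡ arrays τ colA
    following-done zero    τ R eq = refl
    following-done (suc i) τ R eq
      rewrite if-false (differ (var wR) (var tR)) ((wR ← parA [ var wR ]) ▸ markInner) pass
                (setReg traceC i τ) (equal-t {setReg traceC i τ} (matches-setReg traceC i tt R) eq) =
      following-done i (setReg traceC i τ) (matches-setReg traceC i tt R) eq

    following : ∀ i τ {par v ws} → Ready τ → (∀ y → arrays τ parA y ≡ par y) →
      regs τ wR ≡ toℕ v → Traced par v ws → length ws ≤ i →
      arrays (countdown followStep i τ) colA ≡
      paintAll (regs τ finR) (regs τ gR) ws (arrays τ colA)
    following i τ R pr eq end len = following-done i τ R eq
    following (suc i) τ {par} R pr eq (next {v} {w} {ws} v≢t pv v~w T) (s≤s len)
      rewrite if-true (differ (var wR) (var tR)) ((wR ← parA [ var wR ]) ▸ markInner) pass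
                (setReg traceC i τ)
                (differ-t {setReg traceC i τ} (matches-setReg traceC i tt R) eq v≢t)
            | trans (pr (regs τ wR)) (trans (cong par eq) pv)
      with w Fin.≟ t
    ... | yes refl rewrite if-false (differ (var wR) (var tR)) mark pass
                       (setReg wR (toℕ w) (setReg traceC i τ))
                       (equal-t {setReg wR (toℕ w) (setReg traceC i τ)}
                         (matches-setReg {σ = setReg traceC i τ} wR (toℕ w) tt
                           (matches-setReg {σ = τ} traceC i tt R)) refl) =
      following-done i (setReg wR (toℕ w) (setReg traceC i τ))
        (matches-setReg {σ = setReg traceC i τ} wR (toℕ w) tt (matches-setReg {σ = τ} traceC i tt R))
        refl
    ... | no w≢t rewrite if-true (differ (var wR) (var tR)) mark pass
                       (setReg wR (toℕ w) (setReg traceC i τ))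
                       (differ-t {setReg wR (toℕ w) (setReg traceC i τ)}
                         (matches-setReg {σ = setReg traceC i τ} wR (toℕ w) tt
                           (matches-setReg {σ = τ} traceC i tt R)) refl w≢t) =
      trans (following i (⟪ mark ⟫ υ) (matches-kept mark _ _ {υ} R′)
              (λ y → trans (cong-app (keepsArr (only parA) {parA} tt mark _ υ) y) (pr y))
              (keeps (only wR) {wR} tt mark _ υ) T len)
            (cong₃ (keeps (only finR) {finR} tt mark _ υ) (proj₂ spec) (proj₁ spec))
      where
      υ = setReg wR (toℕ w) (setReg traceC i τ)
      R′ : Ready υ
      R′ = matches-setReg {σ = setReg traceC i τ} wR (toℕ w) tt (matches-setReg {σ = τ} traceC i tt R)
      spec = mark-spec υ R′
      cong₃ : ∀ {f f′ g g′ h h′} → f ≡ f′ → g ≡ g′ → h ≡ h′ →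
        paintAll f g ws h ≡ paintAll f′ g′ ws h′
      cong₃ refl refl refl = refl

    react-spec : ∀ σ {ws} → Ready σ → Traced (arrays σ parA) s ws → length ws ≤ ℓ →
      regs (⟪ react ⟫ σ) curR ≡ c + (1 ∸ regs σ gR) ×
      arrays (⟪ react ⟫ σ) colA ≡ paintAll (1 ∸ regs σ gR) (regs σ gR) ws (arrays σ colA)
    react-spec σ {ws} R T len =
      cong₂ _+_ (regsMatch (matches-kept (For traceC To ℓR Do follow) _ _ {σ₂} R₂) curR tt)
                (keeps (only finR) {finR} tt (For traceC To ℓR Do follow) _ σ₂) ,
      subst (λ l → arrays (countdown followStep l (setReg traceC l σ₂)) colA ≡
               paintAll (1 ∸ regs σ gR) (regs σ gR) ws (arrays σ colA))
        (sym (regsMatch R ℓR tt))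
        (following ℓ (setReg traceC ℓ σ₂) (matches-setReg {σ = σ₂} traceC ℓ tt R₂)
          (λ _ → refl) (regsMatch R sR tt) T len)
      where
      σ₁ = setReg finR (1 ∸ regs σ gR) σ
      σ₂ = setReg wR (regs σ sR) σ₁
      R₂ : Ready σ₂
      R₂ = matches-setReg {σ = σ₁} wR _ tt (matches-setReg {σ = σ} finR _ tt R)

  module Route (c : ℕ) (col : ℕ → ℕ) where
    open Searching c col

    record Found (par : ℕ → ℕ) (ws : List Vertex) : Set where
      field
        traced   : Traced par s ws
        distinct : Unique (s ∷ ws)
        free     : ∀ {w} → w ∈ ws → w ≢ t → Allowed w
        short    : length ws ≤ ℓ

    -- Potentials increase strictly along parent pointers and are capped by `ℓ + 1`. Hence following
    -- them ends at `t`, repeats no vertex, and takes at most `ℓ + 1 ∸ pot s` edges, which is at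
    -- most `ℓ` as `s` has positive potential.
    found : ∀ {pot par} → Potential pot par → pot (toℕ s) ≢ 0 → Σ[ ws ∈ List Vertex ] Found par ws
    found {pot} {par} P s≢0 =
      let ws , T , _ , U , F , len = go ℓ s s≢0 (∸-monoʳ-≤ (suc ℓ) (n≢0⇒n>0 s≢0)) in
      ws , record { traced = T ; distinct = U ; free = F
                  ; short = +-cancelʳ-≤ 1 _ _ (≤-trans (+-monoʳ-≤ (length ws) (n≢0⇒n>0 s≢0))
                      (≤-trans len (≤-reflexive (+-comm 1 ℓ)))) }
      where
      go : ∀ i (v : Vertex) → pot (toℕ v) ≢ 0 → suc ℓ ∸ pot (toℕ v) ≤ i →
        Σ[ ws ∈ List Vertex ] (Traced par v ws × All (λ w → pot (toℕ v) < pot (toℕ w)) ws ×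
          Unique (v ∷ ws) × (∀ {w} → w ∈ ws → w ≢ t → Allowed w) × length ws + pot (toℕ v) ≤ suc ℓ)
      go i v v≢0 le with v Fin.≟ t
      ... | yes refl = [] , end , [] , [] ∷ [] , (λ ()) , capped P v
      ... | no v≢t with parent P v v≢0
      ...   | inj₁ v≡t = contradiction v≡t v≢t
      ...   | inj₂ (u , pv , v~u , Av , lt) with i
      ...     | zero = contradiction (≤-trans lt (capped P u))
                  (≤⇒≯ (m∸n≡0⇒m≤n {suc ℓ} (n≤0⇒n≡0 le)))
      ...     | suc i = 
        let ws , T , up , U , F , len = go i u (λ ≡0 → n≮0 (subst (pot (toℕ v) <_) ≡0 lt))
              (≤-pred (≤-trans (∸-monoʳ-< lt (capped P u)) le))
            up′ = lt ∷ All.map (<-trans lt) up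
        in u ∷ ws , next v≢t pv v~u T , up′ ,
           All.map (λ lt eq → <-irrefl (cong (pot ∘ toℕ) eq) lt) up′ ∷ U ,
           (λ { (here refl) u≢t → allowed-of u (λ ≡0 → n≮0 (subst (pot (toℕ v) <_) ≡0 lt)) u≢t
              ; (there w∈) w≢t → F w∈ w≢t }) ,
           ≤-trans (≤-reflexive (sym (+-suc (length ws) _))) (≤-trans (+-monoʳ-≤ (length ws) lt) len)
        where
        allowed-of : ∀ (x : Vertex) → pot (toℕ x) ≢ 0 → x ≢ t → Allowed x
        allowed-of x ≢0 x≢t with parent P x ≢0
        ... | inj₁ x≡t = contradiction x≡t x≢t
        ... | inj₂ (_ , _ , _ , Ax , _) = Ax

-- The choice that brings a solution closer

module _ {A : Set} (f g : A → ℕ) where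

  sum-mono : ∀ xs → (∀ {x} → x ∈ xs → f x ≤ g x) → sum (map f xs) ≤ sum (map g xs)
  sum-mono []       le = z≤n
  sum-mono (x ∷ xs) le = +-mono-≤ (le (here refl)) (sum-mono xs (le ∘ there))

  sum-strict : ∀ {x xs} → x ∈ xs → (∀ {y} → y ∈ xs → f y ≤ g y) → f x < g x →
    sum (map f xs) < sum (map g xs)
  sum-strict {xs = _ ∷ xs} (here refl) le lt = +-mono-<-≤ lt (sum-mono xs (le ∘ there))
  sum-strict (there x∈)  le lt = +-mono-≤-< (le (here refl)) (sum-strict x∈ (le ∘ there) lt)

sum-bound : ∀ {A : Set} (f : A → ℕ) b xs → (∀ {x} → x ∈ xs → f x ≤ b) →
  sum (map f xs) ≤ length xs * b
sum-bound f b []       le = z≤n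
sum-bound f b (x ∷ xs) le = +-mono-≤ (le (here refl)) (sum-bound f b xs (le ∘ there))

module Planning (G : Graph) (s t : Graph.Vertex G) (k ℓ N B M : ℕ) (pw : ℕ → ℕ) where
  open Graph G
  open Instance G s t k ℓ N B M pw
  open Tracing G s t k ℓ N B M pw
  open import Data.List.Membership.DecPropositional (Fin._≟_ {n}) using (_∈?_)

  -- A chain ends in `t`, so any other vertex on it has a successor. This is why a step has
  -- `(ℓ ∸ 1) * k` branching choices and not `ℓ * k`, which keeps `B` at most `k * ℓ`.
  last-index : ∀ {v ws w} → Chain v ws → (w∈ : w ∈ ws) → w ≢ t → 2 + toℕ (Any.index w∈) ≤ length ws
  last-index (_ ∷ end)       (here refl) w≢t = contradiction refl w≢t
  last-index (_ ∷ (_ ∷ _))   (here refl) w≢t = s≤s (s≤s z≤n)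
  last-index (_ ∷ C)         (there w∈)  w≢t = s≤s (last-index C w∈ w≢t)

  -- `1 ∸ col` is 1 exactly for colour 0. The end `t` is never coloured and weighs nothing.
  weight : (ℕ → ℕ) → Vertex → ℕ
  weight col v with v Fin.≟ t
  ... | yes _ = 0
  ... | no  _ = 1 ∸ col (toℕ v)

  weight-mono : ∀ {col col′} v → (v ≢ t → col′ (toℕ v) ≡ 0 → col (toℕ v) ≡ 0) →
    weight col′ v ≤ weight col v
  weight-mono {col} {col′} v imp with v Fin.≟ t
  ... | yes _ = z≤n
  ... | no v≢t with col′ (toℕ v)
  ...   | zero  rewrite imp v≢t refl = ≤-refl
  ...   | suc x = ≤-trans (≤-reflexive (0∸n≡0 x)) z≤n

  weight-painted : ∀ {col} v → (v ≢ t → col (toℕ v) ≢ 0) → weight col v ≡ 0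
  weight-painted v ne with v Fin.≟ t
  ... | yes _  = refl
  ... | no v≢t = m≤n⇒m∸n≡0 (n≢0⇒n>0 (ne v≢t))

  weight-free : ∀ {col} v → v ≢ t → col (toℕ v) ≡ 0 → weight col v ≡ 1
  weight-free v v≢t free with v Fin.≟ t
  ... | yes v≡t = contradiction v≡t v≢t
  ... | no _ rewrite free = refl

  weight≤1 : ∀ col v → weight col v ≤ 1
  weight≤1 col v with v Fin.≟ t
  ... | yes _ = z≤n
  ... | no _  = m∸n≤m 1 (col (toℕ v))

  chain-weight : ∀ col {v ws} → Chain v ws → sum (map (weight col) ws) ≤ length ws ∸ 1
  chain-weight col end = z≤n
  chain-weight col (_ ∷ end) = ≤-reflexive (cong (_+ 0) (weight-painted t (contradiction refl)))
  chain-weight col (_∷_ {w = w} _ C@(_ ∷ _)) = +-mono-≤ (weight≤1 col w) (chain-weight col C)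

  record Solution (c : ℕ) (col : ℕ → ℕ) (X : Fin k → List Vertex) : Set where
    field
      chain    : ∀ j → Chain s (X j)
      short    : ∀ j → length (X j) ≤ ℓ
      disjoint : ∀ i j {v} → i ≢ j → v ∈ X i → v ∈ X j → v ≡ s ⊎ v ≡ t
      coloured : ∀ j {v} → v ∈ X j → v ≢ s → v ≢ t →
                 col (toℕ v) ≡ 0 ⊎ col (toℕ v) ≡ suc (toℕ j)

  uncoloured : (ℕ → ℕ) → (Fin k → List Vertex) → ℕ
  uncoloured col X = sum (map (λ j → sum (map (weight col) (X j))) (allFin k))

  measure : ℕ → (ℕ → ℕ) → (Fin k → List Vertex) → ℕ
  measure c col X = (k ∸ c) + uncoloured col X

  -- The last vertex of a chain is `t`, of weight 0, so a path contributes at most `ℓ ∸ 1`; the unit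
  -- for being unfinished completes this to `ℓ`.
  measure-bound : ∀ {col X} → Solution 0 col X → 1 ≤ ℓ → measure 0 col X ≤ k * ℓ
  measure-bound {col} {X} S 1≤ℓ = begin
    k + uncoloured col X               ≤⟨ +-monoʳ-≤ k (sum-bound _ (ℓ ∸ 1) (allFin k)
                                            (λ {j} _ → ≤-trans (chain-weight col (chain j)) (∸-monoˡ-≤ 1 (short j)))) ⟩
    k + length (allFin k) * (ℓ ∸ 1)    ≡⟨ cong (λ x → k + x * (ℓ ∸ 1)) {y = k} (length-tabulate (λ i → i)) ⟩
    k + k * (ℓ ∸ 1)                    ≡⟨ sym (*-suc k (ℓ ∸ 1)) ⟩
    k * suc (ℓ ∸ 1)                    ≡⟨ cong (k *_) (m+[n∸m]≡n 1≤ℓ) ⟩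
    k * ℓ ∎
    where open Solution S
          open ≤-Reasoning

  module Move (c : ℕ) (col : ℕ → ℕ) (col-s : col (toℕ s) ≡ 0) where
    open Searching c col
    open Following c
    open Route c col

    chain-walk : ∀ {v ws} → Chain v ws → (v ≢ t → Allowed v) → (∀ {w} → w ∈ ws → w ≢ t → Allowed w) →
      Σ[ d ∈ ℕ ] (d ≤ length ws × Walk d v)
    chain-walk {v} C Av Aws with v Fin.≟ t
    chain-walk C         Av Aws | yes refl = 0 , z≤n , start
    chain-walk end       Av Aws | no v≢t   = contradiction refl v≢t
    chain-walk {v} (_∷_ {w = w} v~w C) Av Aws | no v≢t =
      let d , d≤ , W = chain-walk C (Aws (here refl)) (Aws ∘ there)
      in suc d , s≤s d≤ , extend W (~-sym {v} {w} v~w) (Av v≢t)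

    -- Path `c` of the solution itself, read backwards, uses only vertices that the search for `c`
    -- may enter. So the search cannot miss `s`.
    solution-walk : ∀ {X} → Solution c col X → c < k → Σ[ d ∈ ℕ ] (d ≤ ℓ × Walk d s)
    solution-walk {X} S c<k =
      let d , d≤ , W = chain-walk (chain j) (λ _ → inj₁ col-s) ok in d , ≤-trans d≤ (short j) , W
      where
      open Solution S
      j = fromℕ< c<k
      ok : ∀ {w} → w ∈ X j → w ≢ t → Allowed w
      ok {w} w∈ w≢t with w Fin.≟ s
      ... | yes refl = inj₁ col-s
      ... | no w≢s with coloured j w∈ w≢s w≢t
      ...   | inj₁ ≡0 = inj₁ ≡0
      ...   | inj₂ ≡j = inj₂ (trans ≡j (cong suc (toℕ-fromℕ< c<k)))

    module _ {X} (S : Solution c col X) (c<k : c < k) {par ws} (F : Found par ws) where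
      open Solution S
      open Found F hiding (short)

      -- `1 ∸ g` is 1 for the finishing digit 0 and 0 for every other digit.
      Progress : ℕ → Set
      Progress g = Σ[ Y ∈ (Fin k → List Vertex) ]
        (Solution (c + (1 ∸ g)) (paintAll (1 ∸ g) g ws col) Y ×
         measure (c + (1 ∸ g)) (paintAll (1 ∸ g) g ws col) Y < measure c col X)

      Conflict : Vertex → Set
      Conflict w = w ≢ t × ∃ λ j → toℕ j ≢ c × w ∈ X j

      conflict? : ∀ w → Dec (Conflict w)
      conflict? w = ¬? (w Fin.≟ t) ×-dec Fin.any? (λ j → ¬? (toℕ j ≟ c) ×-dec (w ∈? X j))

      ≢s : ∀ {w} → w ∈ ws → w ≢ s
      ≢s w∈ refl with distinct
      ... | s∉ ∷ _ = All.lookup s∉ w∈ refl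

      -- As a vertex of the path found, `w` is open or reserved for `c`; as a vertex of path `j` it
      -- is open or reserved for `j`. Since `j` differs from `c`, it is open. Reserving it for `j`
      -- hurts no other path, as disjointness keeps those away from `w`.
      branch : ∀ {w} (w∈ : w ∈ ws) → w ≢ t → ∀ j → toℕ j ≢ c → w ∈ X j →
        Progress (suc (toℕ (Any.index w∈) * k + toℕ j))
      branch {w} w∈ w≢t j j≢c w∈X 
        rewrite 0∸n≡0 (toℕ (Any.index w∈) * k + toℕ j) | +-identityʳ c =
        X , record { chain = chain ; short = short ; disjoint = disjoint ; coloured = coloured′ } ,
        +-monoʳ-< (k ∸ c) (sum-strict _ _ (∈-allFin j) (λ {i} _ → sum-mono _ _ (X i) (λ {v} _ → lighter v))
          (sum-strict _ _ w∈X (λ {v} _ → lighter v)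
            (≤-reflexive (trans (cong suc (weight-painted w (λ _ ≡0 → 1+n≢0 (trans (sym painted) ≡0))))
                                (sym (weight-free w w≢t w-free))))))
        where
        col′ = paintAll 0 (suc (toℕ (Any.index w∈) * k + toℕ j)) ws col
        spec = paintAll-branch col traced w∈ w≢t (toℕ<n j)
        painted : col′ (toℕ w) ≡ suc (toℕ j)
        painted = proj₁ spec
        w-free : col (toℕ w) ≡ 0
        w-free with free w∈ w≢t | coloured j w∈X (≢s w∈) w≢t
        ... | inj₁ ≡0 | _       = ≡0
        ... | _       | inj₁ ≡0 = ≡0
        ... | inj₂ ≡c | inj₂ ≡j = contradiction (suc-injective (trans (sym ≡j) ≡c)) j≢c
        lighter : ∀ v → weight col′ v ≤ weight col v
        lighter v = weight-mono v λ v≢t ≡0 → case v Fin.≟ w of λ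
          { (yes refl) → w-free
          ; (no v≢w) → trans (sym (proj₂ spec (toℕ v) (λ eq → v≢w (sym (toℕ-injective eq))))) ≡0 }
        coloured′ : ∀ i {v} → v ∈ X i → v ≢ s → v ≢ t → col′ (toℕ v) ≡ 0 ⊎ col′ (toℕ v) ≡ suc (toℕ i)
        coloured′ i {v} v∈ v≢s v≢t with v Fin.≟ w
        ... | no v≢w rewrite proj₂ spec (toℕ v) (λ eq → v≢w (sym (toℕ-injective eq))) = coloured i v∈ v≢s v≢t
        ... | yes refl with i Fin.≟ j
        ...   | yes refl = inj₂ painted
        ...   | no i≢j with disjoint i j i≢j v∈ w∈X
        ...     | inj₁ v≡s = contradiction v≡s v≢s
        ...     | inj₂ v≡t = contradiction v≡t v≢t

      -- Path `c` is replaced by `ws`, which meets the others at most in `t`, so painting `ws` does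
      -- not affect their inner vertices. The new path has weight 0, no other weight grows, and
      -- `k ∸ c` drops by one.
      finish : (∀ {w} → w ∈ ws → ¬ Conflict w) → Progress 0
      finish none rewrite +-comm c 1 =
        Y , record { chain = chain′ ; short = short′ ; disjoint = disjoint′ ; coloured = coloured′ } ,
        +-mono-<-≤ (∸-monoʳ-< ≤-refl c<k) (sum-mono _ _ (allFin k) (λ {j} _ → fewer j))
        where
        col′ = paintAll 1 0 ws col
        Y : Fin k → List Vertex
        Y j with toℕ j ≟ c
        ... | yes _ = ws
        ... | no  _ = X j
        chain′ : ∀ j → Chain s (Y j)
        chain′ j with toℕ j ≟ c
        ... | yes _ = traced⇒chain _ traced
        ... | no  _ = chain j
        short′ : ∀ j → length (Y j) ≤ ℓ
        short′ j with toℕ j ≟ c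
        ... | yes _ = Found.short F
        ... | no  _ = short j
        only-t-shared : ∀ {v j} → v ∈ ws → toℕ j ≢ c → v ∈ X j → v ≡ t
        only-t-shared {v} {j} v∈ws j≢c v∈X with v Fin.≟ t
        ... | yes v≡t = v≡t
        ... | no v≢t = contradiction (v≢t , j , j≢c , v∈X) (none v∈ws)
        disjoint′ : ∀ i j {v} → i ≢ j → v ∈ Y i → v ∈ Y j → v ≡ s ⊎ v ≡ t
        disjoint′ i j i≢j v∈i v∈j with toℕ i ≟ c | toℕ j ≟ c
        ... | yes refl | yes eq   = contradiction (toℕ-injective (sym eq)) i≢j
        ... | yes refl | no  j≢c  = inj₂ (only-t-shared v∈i j≢c v∈j)
        ... | no  i≢c  | yes refl = inj₂ (only-t-shared v∈j i≢c v∈i)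
        ... | no  _    | no  _    = disjoint i j i≢j v∈i v∈j
        painted : ∀ {v} → v ∈ ws → v ≢ t → col′ (toℕ v) ≡ suc c
        painted = paintAll-finish 0 0 col traced
        unpainted : ∀ {v} → ¬ (v ∈ ws) → col′ (toℕ v) ≡ col (toℕ v)
        unpainted v∉ = paintAll-other 1 0 ws col _
          (λ x x∈ _ eq → v∉ (subst (_∈ ws) (toℕ-injective eq) x∈))
        coloured′ : ∀ j {v} → v ∈ Y j → v ≢ s → v ≢ t → col′ (toℕ v) ≡ 0 ⊎ col′ (toℕ v) ≡ suc (toℕ j)
        coloured′ j {v} v∈ v≢s v≢t with toℕ j ≟ c
        ... | yes refl = inj₂ (painted v∈ v≢t)
        ... | no j≢c with v ∈? ws
        ...   | yes v∈ws = contradiction (only-t-shared v∈ws j≢c v∈) v≢t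
        ...   | no v∉ rewrite unpainted v∉ = coloured j v∈ v≢s v≢t
        lighter : ∀ v → weight col′ v ≤ weight col v
        lighter v = weight-mono v imp
          where
          imp : v ≢ t → col′ (toℕ v) ≡ 0 → col (toℕ v) ≡ 0
          imp v≢t ≡0 with v ∈? ws
          ... | yes v∈ = contradiction (trans (sym (painted v∈ v≢t)) ≡0) 1+n≢0
          ... | no v∉  = trans (sym (unpainted v∉)) ≡0
        fewer : ∀ j → sum (map (weight col′) (Y j)) ≤ sum (map (weight col) (X j))
        fewer j with toℕ j ≟ c
        ... | no _  = sum-mono _ _ (X j) (λ {v} _ → lighter v)
        ... | yes _ = ≤-trans (sum-bound _ 0 ws (λ {v} v∈ → ≤-reflexive
                (weight-painted v (λ v≢t ≡0 → 1+n≢0 (trans (sym (painted v∈ v≢t)) ≡0)))))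
                (≤-trans (≤-reflexive (*-zeroʳ (length ws))) z≤n)

      move : Σ[ g ∈ ℕ ] (g ≤ (ℓ ∸ 1) * k × Progress g)
      move with Any.any? conflict? ws
      ... | no none = 0 , z≤n , finish (λ w∈ conf → none (Any.map (λ { refl → conf }) w∈))
      ... | yes some with find some
      ...   | w , w∈ , w≢t , j , j≢c , w∈X = _ , small , branch w∈ w≢t j j≢c w∈X
        where
        open ≤-Reasoning
        p = toℕ (Any.index w∈)
        -- Both bounds are strict: `j < k`, and `p + 1 ≤ ℓ ∸ 1` because `w` is not the last vertex.
        small : suc (p * k + toℕ j) ≤ (ℓ ∸ 1) * k
        small = begin
          suc (p * k + toℕ j) ≡⟨ sym (+-suc (p * k) (toℕ j)) ⟩
          p * k + suc (toℕ j) ≤⟨ +-monoʳ-≤ (p * k) (toℕ<n j) ⟩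
          p * k + k           ≡⟨ +-comm (p * k) k ⟩
          suc p * k           ≤⟨ *-monoˡ-≤ k (∸-monoˡ-≤ 1 (≤-trans (last-index (traced⇒chain _ traced) w∈ w≢t) (Found.short F))) ⟩
          (ℓ ∸ 1) * k ∎

-- A single attempt

-- The registers in which attempts may still differ after the reset.
volatile : Var → Bool
volatile r = (r ≡ᵇ ansR) ∨ ((r ≡ᵇ codeR) ∨ (r ≡ᵇ codeC))

extracting : Loop
extracting =
  If (var codeR ⊕ lit 1) ⊖ (powA [ var stepC ]) Then
    ((codeR ← var codeR ⊖ (powA [ var stepC ])) ▸ (gR ← var gR ⊕ lit 1))
  Else pass

-- The invariant writes the code as `a * p + y` with `a` subtractions still due. Rounds after `a`
-- has reached 0 fail the test because `y < p`.
extract-spec : ∀ σ {b p γ y} → regs σ digitsR ≡ b → arrays σ powA (regs σ stepC) ≡ p →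
  regs σ codeR ≡ γ * p + y → γ ≤ b → y < p →
  regs (⟪ extract ⟫ σ) gR ≡ γ × regs (⟪ extract ⟫ σ) codeR ≡ y × regs (⟪ extract ⟫ σ) digitC ≡ 0
extract-spec σ {b} {p} {γ} {y} refl powEq codeEq γ≤b y<p with final
  where
  q = regs σ stepC
  I : ℕ → State → Set
  I i τ = regs τ digitC ≡ i × regs τ stepC ≡ q × arrays τ powA ≡ arrays σ powA ×
    Σ[ a ∈ ℕ ] (regs τ codeR ≡ a * p + y × regs τ gR + a ≡ γ × a ≤ i)

  power : ∀ τ → regs τ stepC ≡ q → arrays τ powA ≡ arrays σ powA →
    arrays τ powA (regs τ stepC) ≡ p
  power τ stepEq arrEq =
    trans (cong-app arrEq _) (trans (cong (arrays σ powA) stepEq) powEq)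

  test : ∀ τ {a} → arrays τ powA (regs τ stepC) ≡ p → regs τ codeR ≡ suc a * p + y →
    regs τ codeR + 1 ∸ arrays τ powA (regs τ stepC) ≢ 0
  test τ {a} powEq codeEq ≡0 =
    <⇒≱ (≤-trans (s≤s (≤-trans (m≤m+n p (a * p)) (m≤m+n (p + a * p) y)))
           (≤-reflexive (trans (cong suc (sym codeEq)) (+-comm 1 _))))
        (≤-trans (m∸n≡0⇒m≤n {_} {arrays τ powA (regs τ stepC)} ≡0) (≤-reflexive powEq))

  body : ∀ i τ → i < b → I (suc i) τ → I i (⟪ extracting ⟫ (setReg digitC i τ))
  body i τ i<b (_ , stepEq , arrEq , zero , codeEq , gEq , _)
    rewrite arrEq | stepEq | powEq | codeEq | +-comm y 1 | m≤n⇒m∸n≡0 y<p =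
    refl , stepEq , arrEq , 0 , codeEq , gEq , z≤n
  body i τ i<b (_ , stepEq , arrEq , suc a , codeEq , gEq , s≤s a≤i)
    rewrite if-true ((var codeR ⊕ lit 1) ⊖ (powA [ var stepC ]))
              ((codeR ← var codeR ⊖ (powA [ var stepC ])) ▸ (gR ← var gR ⊕ lit 1)) pass
              (setReg digitC i τ) (test τ {a} (power τ stepEq arrEq) codeEq) =
    refl , stepEq , arrEq , a ,
    trans (cong₂ _∸_ codeEq (power τ stepEq arrEq)) (trans (cong (_∸ p) (+-assoc p (a * p) y)) (m+n∸m≡n p _)) ,
    trans (+-assoc (regs τ gR) 1 a) gEq , a≤i

  σ₁ = setReg digitC b (setReg gR 0 σ)
  final : I 0 (⟪ extract ⟫ σ)
  final = countdown-invariant I _ b body σ₁ (refl , refl , refl , γ , codeEq , refl , γ≤b)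
... | dEq , _ , _ , a , codeEq′ , gEq , z≤n = trans (sym (+-identityʳ _)) gEq , codeEq′ , dEq

-- The reference run has no code to read: the planned digit is put into `gR` by hand. A run whose
-- code supplies this digit then agrees with it, the rest of the code being volatile.
extract-agree : ∀ {σ τ γ} → AgreeOff volatile σ τ →
  regs (⟪ extract ⟫ τ) gR ≡ γ → regs (⟪ extract ⟫ τ) digitC ≡ 0 →
  AgreeOff volatile (setReg gR γ (setReg digitC 0 σ)) (⟪ extract ⟫ τ)
extract-agree {σ} {τ} {γ} (agree ra aa) gEq dEq = agree ra′ aa′
  where
  untouched : Var → Bool
  untouched r = not ((gR ≡ᵇ r) ∨ ((digitC ≡ᵇ r) ∨ (codeR ≡ᵇ r)))
  ra′ : ∀ r → T (not (volatile r)) →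
    regs (setReg gR γ (setReg digitC 0 σ)) r ≡ regs (⟪ extract ⟫ τ) r
  ra′ r vol with gR ≟ r | digitC ≟ r | codeR ≟ r
  ... | yes refl | _        | _        = sym gEq
  ... | no _     | yes refl | _        = sym dEq
  ... | no _     | no _     | yes refl with vol
  ...   | ()
  ra′ r vol | no g≢r | no d≢r | no c≢r =
    trans (update-other (regs (setReg digitC 0 σ)) γ g≢r) (trans (update-other (regs σ) 0 d≢r)
      (trans (ra r vol) (sym (keeps untouched ok extract _ τ))))
    where
    ok : T (untouched r)
    ok rewrite ≡ᵇ-≢ g≢r | ≡ᵇ-≢ d≢r | ≡ᵇ-≢ c≢r = tt
  aa′ : ∀ a y → arrays σ a y ≡ arrays (⟪ extract ⟫ τ) a y
  aa′ a y = trans (aa a y) (cong-app (sym (keepsArr (λ _ → true) {a} tt extract _ τ)) y)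

solveLoop : ℕ → State → State
solveLoop = countdown (λ q τ → ⟪ oneStep ⟫ (setReg stepC q τ))

module Solving (G : Graph) (s t : Graph.Vertex G) (k ℓ : ℕ) (pw : ℕ → ℕ) where
  open Graph G

  N B M : ℕ
  N = k * ℓ
  B = suc ((ℓ ∸ 1) * k)
  M = B ^ N

  open Instance G s t k ℓ N B M pw
  open Tracing G s t k ℓ N B M pw
  open Planning G s t k ℓ N B M pw
  open import Data.List.Membership.DecPropositional (Fin._≟_ {n}) using (_∈?_)

  Static : State → Set
  Static = Matches 9 3 (ρ₀ 0) (α₀ (λ _ → 0))

  record Blank (col : ℕ → ℕ) : Set where
    constructor blank
    field
      beyond : ∀ y → n ≤ y → col y ≡ 0
      at-s   : col (toℕ s) ≡ 0
      at-t   : col (toℕ t) ≡ 0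

  -- Clearing reaches only the cells below `n`. With zeros beyond them, cleared arrays agree at
  -- every index, as `AgreeOff` demands. `Blank` also keeps `s` open, so that a search may end
  -- there.
  record Good (σ : State) : Set where
    constructor good
    field
      static : Static σ
      unused : ∀ y → n ≤ y → arrays σ potA y ≡ 0 × arrays σ parA y ≡ 0
      colour : Blank (arrays σ colA)

  static⇒context : ∀ {σ} → Static σ →
    Matches 10 4 (ρ₀ (regs σ curR)) (α₀ (arrays σ colA)) σ
  static⇒context S = matches
    (λ { 0 _ → regsMatch S 0 tt ; 1 _ → regsMatch S 1 tt ; 2 _ → regsMatch S 2 tt
       ; 3 _ → regsMatch S 3 tt ; 4 _ → regsMatch S 4 tt ; 5 _ → regsMatch S 5 tt
       ; 6 _ → regsMatch S 6 tt ; 7 _ → regsMatch S 7 tt ; 8 _ → regsMatch S 8 tt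
       ; 9 _ → refl ; (suc (suc (suc (suc (suc (suc (suc (suc (suc (suc _)))))))))) () })
    (λ { 0 _ → arraysMatch S 0 tt ; 1 _ → arraysMatch S 1 tt ; 2 _ → arraysMatch S 2 tt
       ; 3 _ _ → refl ; (suc (suc (suc (suc _)))) () })

  context⇒static : ∀ {c col σ} → Matches 10 4 (ρ₀ c) (α₀ col) σ → Static σ
  context⇒static C = matches
    (λ { 0 _ → regsMatch C 0 tt ; 1 _ → regsMatch C 1 tt ; 2 _ → regsMatch C 2 tt
       ; 3 _ → regsMatch C 3 tt ; 4 _ → regsMatch C 4 tt ; 5 _ → regsMatch C 5 tt
       ; 6 _ → regsMatch C 6 tt ; 7 _ → regsMatch C 7 tt ; 8 _ → regsMatch C 8 tt
       ; (suc (suc (suc (suc (suc (suc (suc (suc (suc _))))))))) () })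
    (λ { 0 _ → arraysMatch C 0 tt ; 1 _ → arraysMatch C 1 tt ; 2 _ → arraysMatch C 2 tt
       ; (suc (suc (suc _))) () })

  context⇒ready : ∀ {c col σ} → Matches 10 4 (ρ₀ c) (α₀ col) σ →
    Matches 10 3 (ρ₀ c) (α₀ (λ _ → 0)) σ
  context⇒ready C = matches (regsMatch C) (arraysMatch (context⇒static C))

  good-setReg : ∀ {σ} x v → T (not (x <ᵇ 9)) → Good σ → Good (setReg x v σ)
  good-setReg {σ} x v x≥9 (good S u b) = good (matches-setReg {σ = σ} x v x≥9 S) u b

  record Searched (c : ℕ) (col : ℕ → ℕ) (υ : State) : Set where
    constructor searched
    field
      context : Searching.Context c col υ
      colEq   : arrays υ colA ≡ col
      valid   : Searching.Valid c col υ

  search-searched : ∀ {σ} → Good σ → Searched (regs σ curR) (arrays σ colA) (⟪ search ⟫ σ)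
  search-searched {σ} (good S u b) =
    let C , V , _ = Searching.search-spec _ _ σ (static⇒context S) u
    in searched C (keepsArr (only colA) {colA} tt search _ σ) V

  extract-searched : ∀ {c col υ} → Searched c col υ → Searched c col (⟪ extract ⟫ υ)
  extract-searched {c} {col} {υ} (searched C e V) =
    searched (matches-kept extract _ _ C) (trans (keepsArr (only colA) {colA} tt extract _ υ) e)
      (subst₂ (Searching.Potential c col) (sym (keepsArr (only potA) {potA} tt extract _ υ))
        (sym (keepsArr (only parA) {parA} tt extract _ υ)) V)

  setReg-searched : ∀ {c col υ} x v → T (not (x <ᵇ 10)) → Searched c col υ → Searched c col (setReg x v υ)
  setReg-searched {υ = υ} x v x≥10 (searched C e V) = searched (matches-setReg {σ = υ} x v x≥10 C) e V

  searched-good : ∀ {c col υ} → Searched c col υ → Blank col → Good υ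
  searched-good (searched C refl V) b = good (context⇒static C) (Searching.Potential.unused V) b

  module _ {c : ℕ} {col : ℕ → ℕ} where
    open Searching c col using (Allowed)
    open Following c
    open Route c col

    ws≢s : ∀ {par ws w} → Found par ws → w ∈ ws → w ≢ s
    ws≢s F w∈ refl with Found.distinct F
    ... | s∉ ∷ _ = All.lookup s∉ w∈ refl

    unpainted : ∀ fin g {ws v} → ¬ (v ∈ ws) → paintAll fin g ws col (toℕ v) ≡ col (toℕ v)
    unpainted fin g {ws} {v} v∉ = paintAll-other fin g ws col (toℕ v)
      (λ x x∈ _ eq → v∉ (subst (_∈ ws) (toℕ-injective eq) x∈))

    react-good : ∀ {υ ws} → Searched c col υ → Blank col → Found (arrays υ parA) ws →
      let g = regs υ gR in
      Good (⟪ react ⟫ υ) × regs (⟪ react ⟫ υ) curR ≡ c + (1 ∸ g) ×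
      arrays (⟪ react ⟫ υ) colA ≡ paintAll (1 ∸ g) g ws col
    react-good {υ} {ws} (searched C refl V) (blank beyond at-s at-t) F =
      good (matches-kept react _ _ (context⇒static C))
        (λ y n≤y → let potEq , parEq = Searching.Potential.unused V y n≤y in
           trans (cong-app (keepsArr (only potA) {potA} tt react _ υ) y) potEq ,
           trans (cong-app (keepsArr (only parA) {parA} tt react _ υ) y) parEq)
        (subst Blank (sym (proj₂ spec)) (blank
          (λ y n≤y → trans (paintAll-other _ _ ws col y
             (λ x _ _ eq → <⇒≱ (toℕ<n x) (≤-trans n≤y (≤-reflexive (sym eq))))) (beyond y n≤y))
          (trans (paintAll-other _ _ ws col _ (λ x x∈ _ eq → ws≢s F x∈ (toℕ-injective eq))) at-s)
          (trans (paintAll-other _ _ ws col _ (λ x _ x≢t eq → x≢t (toℕ-injective eq))) at-t))) ,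
      spec
      where
      spec = react-spec υ (context⇒ready C) (Found.traced F) (Found.short F)

  -- A vertex has only one colour, so the finished paths 0, …, c − 1 are disjoint.
  Sound : ℕ → (ℕ → ℕ) → Set
  Sound c col = ∀ (j : Fin k) → toℕ j < c → Σ[ ws ∈ List Vertex ]
    (Chain s ws × Unique (s ∷ ws) × length ws ≤ ℓ ×
     (∀ {v} → v ∈ ws → v ≢ t → col (toℕ v) ≡ suc (toℕ j)))

  -- Painting affects only vertices of `ws` other than `t`, and these are open or of colour `c + 1`.
  -- A finished path `j < c` has colour `j + 1` and stays intact. With digit 0 the list `ws` itself
  -- becomes path `c`.
  paint-sound : ∀ {c col par ws} g → Route.Found c col par ws → Sound c col →
    Sound (c + (1 ∸ g)) (Following.paintAll c (1 ∸ g) g ws col)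
  paint-sound {c} {col} {ws = ws} g F S j j<c′ with toℕ j <? c
  ... | yes j<c = let xs , C , U , len , colEq = S j j<c in
    xs , C , U , len , λ v∈ v≢t → trans (untouched v∈ v≢t (colEq v∈ v≢t)) (colEq v∈ v≢t)
    where
    untouched : ∀ {v xs} → v ∈ xs → v ≢ t → col (toℕ v) ≡ suc (toℕ j) →
      Following.paintAll c (1 ∸ g) g ws col (toℕ v) ≡ col (toℕ v)
    untouched {v} _ v≢t ≡j with v ∈? ws
    ... | no v∉ = unpainted (1 ∸ g) g v∉
    ... | yes v∈ws with Route.Found.free F v∈ws v≢t
    ...   | inj₁ ≡0 = contradiction (trans (sym ≡j) ≡0) 1+n≢0
    ...   | inj₂ ≡c = contradiction (suc-injective (trans (sym ≡j) ≡c)) (<⇒≢ j<c)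
  paint-sound {c} (suc g) F S j j<c′ | no j≮c =
    contradiction (≤-trans j<c′ (≤-reflexive (trans (cong (c +_) (0∸n≡0 g)) (+-identityʳ c)))) j≮c
  paint-sound {c} {col} {ws = ws} zero F S j j<c′ | no j≮c =
    ws , traced⇒chain _ traced , distinct , short , λ v∈ v≢t →
      trans (Following.paintAll-finish c 0 0 col traced v∈ v≢t) (cong suc (sym j≡c))
    where
    open Route.Found F
    j≡c : toℕ j ≡ c
    j≡c = ≤-antisym (≤-pred (≤-trans j<c′ (≤-reflexive (+-comm c 1)))) (≮⇒≥ j≮c)

  oneStep-stop : ∀ {σ} → Static σ → k ≤ regs σ curR → ⟪ oneStep ⟫ σ ≡ σ
  oneStep-stop {σ} S k≤c =
    if-false (var kR ⊖ var curR) (search ▸ extract ▸ reactIfReached) pass σ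
      (m≤n⇒m∸n≡0 (≤-trans (≤-reflexive (regsMatch S kR tt)) k≤c))

  afterExtract : State → State
  afterExtract σ = ⟪ extract ⟫ (⟪ search ⟫ σ)

  oneStep-go : ∀ {σ} → Static σ → regs σ curR < k →
    ⟪ oneStep ⟫ σ ≡ ⟪ reactIfReached ⟫ (afterExtract σ)
  oneStep-go {σ} S c<k =
    if-true (var kR ⊖ var curR) (search ▸ extract ▸ reactIfReached) pass σ
      (λ ≡0 → <⇒≱ c<k (≤-trans (≤-reflexive (sym (regsMatch S kR tt))) (m∸n≡0⇒m≤n ≡0)))

  StateSound : State → Set
  StateSound σ = Good σ × Sound (regs σ curR) (arrays σ colA)

  reached : ∀ {c col υ} → Searched c col υ → ⟦ potA [ var sR ] ⟧ υ ≢ 0 → Searching.pot c col υ s ≢ 0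
  reached {υ = υ} D ≢0 ≡0 =
    ≢0 (trans (cong (arrays υ potA) (regsMatch (Searched.context D) sR tt)) ≡0)

  reactIfReached-sound : ∀ {c col} υ → Searched c col υ → Blank col → Sound c col →
    StateSound (⟪ reactIfReached ⟫ υ)
  reactIfReached-sound {c} {col} υ D b S = by-cases (⟦ potA [ var sR ] ⟧ υ ≟ 0)
    where
    by-cases : Dec (⟦ potA [ var sR ] ⟧ υ ≡ 0) → StateSound (⟪ reactIfReached ⟫ υ)
    by-cases (yes ≡0) = subst StateSound (sym (if-false (potA [ var sR ]) react pass υ ≡0))
      (searched-good D b ,
       subst₂ Sound (sym (regsMatch (Searched.context D) curR tt)) (sym (Searched.colEq D)) S)
    by-cases (no ≢0) =
      let ws , F = Route.found c col (Searched.valid D) (reached D ≢0)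
          Gτ , cEq , colEq = react-good D b F
      in subst StateSound (sym (if-true (potA [ var sR ]) react pass υ ≢0))
           (Gτ , subst₂ Sound (sym cEq) (sym colEq) (paint-sound (regs υ gR) F S))

  -- No assumption is made on the digit: a wrong choice can prevent paths from being finished but
  -- cannot spoil finished ones.
  oneStep-sound : ∀ σ → StateSound σ → StateSound (⟪ oneStep ⟫ σ)
  oneStep-sound σ (Gσ , Sσ) = by-cases (k ≤? regs σ curR)
    where
    by-cases : Dec (k ≤ regs σ curR) → StateSound (⟪ oneStep ⟫ σ)
    by-cases (yes k≤c) = subst StateSound (sym (oneStep-stop (Good.static Gσ) k≤c)) (Gσ , Sσ)
    by-cases (no k≰c)  = subst StateSound (sym (oneStep-go (Good.static Gσ) (≰⇒> k≰c)))
      (reactIfReached-sound (afterExtract σ) (extract-searched (search-searched Gσ))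
        (Good.colour Gσ) Sσ)

  solveLoop-sound : ∀ i σ → StateSound σ → StateSound (solveLoop i σ)
  solveLoop-sound = countdown-preserves StateSound (λ q τ → ⟪ oneStep ⟫ (setReg stepC q τ))
    (λ i τ Sτ → oneStep-sound (setReg stepC i τ) (good-setReg {τ} stepC i tt (proj₁ Sτ) , proj₂ Sτ))

  solveLoop-stays : ∀ i σ → Good σ → k ≤ regs σ curR → k ≤ regs (solveLoop i σ) curR
  solveLoop-stays zero    σ Gσ k≤c = k≤c
  solveLoop-stays (suc i) σ Gσ k≤c =
    subst (λ τ → k ≤ regs (solveLoop i τ) curR)
      (sym (oneStep-stop (Good.static (good-setReg {σ} stepC i tt Gσ)) k≤c))
      (solveLoop-stays i (setReg stepC i σ) (good-setReg {σ} stepC i tt Gσ) k≤c)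

  agree-good : ∀ {σ τ} → AgreeOff volatile σ τ → Good σ → Good τ
  agree-good {σ} {τ} (agree ra aa) (good S u (blank beyond at-s at-t)) = good
    (matches (λ x x<9 → trans (sym (ra x (stable x x<9))) (regsMatch S x x<9))
             (λ a a<3 y → trans (sym (aa a y)) (arraysMatch S a a<3 y)))
    (λ y n≤y → trans (sym (aa potA y)) (proj₁ (u y n≤y)) , trans (sym (aa parA y)) (proj₂ (u y n≤y)))
    (blank (λ y n≤y → trans (sym (aa colA y)) (beyond y n≤y))
           (trans (sym (aa colA _)) at-s) (trans (sym (aa colA _)) at-t))
    where
    stable : ∀ x → T (x <ᵇ 9) → T (not (volatile x))
    stable x x<9 rewrite ≡ᵇ-≢ {x} {ansR} (λ { refl → x<9 })
                       | ≡ᵇ-≢ {x} {codeR} (λ { refl → x<9 })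
                       | ≡ᵇ-≢ {x} {codeC} (λ { refl → x<9 }) = tt

  -- Quantifying over `τ` is essential: the code is planned at `σ`, while the run that tries it has
  -- its own answer, code and code counter.
  Succeeds : ℕ → State → ℕ → Set
  Succeeds i σ y = ∀ τ → AgreeOff volatile σ τ → regs τ codeR ≡ y → k ≤ regs (solveLoop i τ) curR

  module _ (power : ∀ q → q < N → pw q ≡ B ^ q) where

    -- The leading digit `g` comes from `move`. The reference run is continued with it, and
    -- `continue`, the induction hypothesis, supplies the remaining digits `y`. An actual run with
    -- code `g * B ^ i + y` extracts `g`, follows the reference run through `react`, and is left
    -- with the code `y`.
    good-step : ∀ {i σ X} → i < N → Good σ → Solution (regs σ curR) (arrays σ colA) X →
      measure (regs σ curR) (arrays σ colA) X ≤ suc i → regs σ curR < k →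
      (∀ ρ Y → Good ρ → Solution (regs ρ curR) (arrays ρ colA) Y →
         measure (regs ρ curR) (arrays ρ colA) Y ≤ i → Σ[ y ∈ ℕ ] (y < B ^ i × Succeeds i ρ y)) →
      Σ[ y ∈ ℕ ] (y < B ^ suc i × Succeeds (suc i) σ y)
    good-step {i} {σ} {X} i<N Gσ Sol le c<k continue =
      g * B ^ i + y ,
      (begin-strict
        g * B ^ i + y      <⟨ +-monoʳ-< (g * B ^ i) y< ⟩
        g * B ^ i + B ^ i  ≡⟨ +-comm (g * B ^ i) (B ^ i) ⟩
        suc g * B ^ i      ≤⟨ *-monoˡ-≤ (B ^ i) (s≤s g≤) ⟩
        B * B ^ i ∎) ,
      success
      where
      open ≤-Reasoning
      c = regs σ curR
      col = arrays σ colA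
      σq = setReg stepC i σ
      Gq : Good σq
      Gq = good-setReg {σ} stepC i tt Gσ
      σ₁ = ⟪ search ⟫ σq
      D₁ : Searched c col σ₁
      D₁ = search-searched Gq
      walk = Move.solution-walk c col (Blank.at-s (Good.colour Gσ)) Sol c<k
      s-reached : Searching.pot c col σ₁ s ≢ 0
      s-reached = proj₂ (proj₂ (Searching.search-spec c col σq (static⇒context (Good.static Gq)) (Good.unused Gq)))
        (proj₁ (proj₂ walk)) (proj₂ (proj₂ walk))
      route = Route.found c col (Searched.valid D₁) s-reached
      plan = Move.move c col (Blank.at-s (Good.colour Gσ)) Sol c<k (proj₂ route)
      g = proj₁ plan
      g≤ = proj₁ (proj₂ plan)
      Y = proj₁ (proj₂ (proj₂ plan))
      progress = proj₂ (proj₂ (proj₂ plan))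
      σ₂ = setReg gR g (setReg digitC 0 σ₁)
      D₂ : Searched c col σ₂
      D₂ = setReg-searched {υ = setReg digitC 0 σ₁} gR g tt (setReg-searched {υ = σ₁} digitC 0 tt D₁)
      ρ = ⟪ react ⟫ σ₂
      reacted = react-good D₂ (Good.colour Gσ) (proj₂ route)
      cEq = proj₁ (proj₂ reacted)
      colEq = proj₂ (proj₂ reacted)
      rest = continue ρ Y (proj₁ reacted)
        (subst₂ (λ c col → Solution c col Y) (sym cEq) (sym colEq) (proj₁ progress))
        (≤-pred (≤-trans (subst₂ (λ c′ col′ → measure c′ col′ Y < measure c col X)
                            (sym cEq) (sym colEq) (proj₂ progress)) le))
      y = proj₁ rest
      y< = proj₁ (proj₂ rest)
      success : Succeeds (suc i) σ (g * B ^ i + y)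
      success τ A codeEq = subst (λ υ → k ≤ regs (solveLoop i υ) curR) (sym stepEq)
        (proj₂ (proj₂ rest) (⟪ react ⟫ τ₂) (unaware react _ A₂)
          (trans (keeps (only codeR) {codeR} tt react _ τ₂) (proj₁ (proj₂ spec))))
        where
        τq = setReg stepC i τ
        Gτ : Good τq
        Gτ = good-setReg {τ} stepC i tt (agree-good A Gσ)
        τ₁ = ⟪ search ⟫ τq
        A₁ : AgreeOff volatile σ₁ τ₁
        A₁ = unaware search _ (agree-setReg stepC refl A)
        S₁ : Static τ₁
        S₁ = matches-kept search _ _ (Good.static Gτ)
        τ₂ = ⟪ extract ⟫ τ₁
        spec = extract-spec τ₁ {y = y} (regsMatch S₁ digitsR tt)
          (trans (arraysMatch S₁ powA tt _)
             (trans (cong pw (keeps (only stepC) {stepC} tt search _ τq)) (power i i<N)))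
          (trans (keeps (only codeR) {codeR} tt search _ τq) codeEq)
          (m≤n⇒m≤1+n g≤) y<
        A₂ : AgreeOff volatile σ₂ τ₂
        A₂ = extract-agree A₁ (proj₁ spec) (proj₂ (proj₂ spec))
        stepEq : ⟪ oneStep ⟫ τq ≡ ⟪ react ⟫ τ₂
        stepEq = trans
          (oneStep-go (Good.static Gτ) (subst (_< k) (AgreeOff.regsAgree A curR tt) c<k))
          (if-true (potA [ var sR ]) react pass τ₂ (λ ≡0 → s-reached
            (trans (cong (arrays σ₁ potA) (sym (regsMatch (Searched.context D₁) sR tt)))
              (trans (AgreeOff.arraysAgree A₂ potA _)
                (trans (cong (arrays τ₂ potA) (AgreeOff.regsAgree A₂ sR tt)) ≡0)))))

    solveLoop-complete : ∀ i → i ≤ N → ∀ σ X → Good σ → Solution (regs σ curR) (arrays σ colA) X →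
      measure (regs σ curR) (arrays σ colA) X ≤ i → Σ[ y ∈ ℕ ] (y < B ^ i × Succeeds i σ y)
    solveLoop-complete i i≤N σ X Gσ Sol le = by-cases (k ≤? regs σ curR) i i≤N le
      where
      by-cases : Dec (k ≤ regs σ curR) → ∀ i → i ≤ N → measure (regs σ curR) (arrays σ colA) X ≤ i →
        Σ[ y ∈ ℕ ] (y < B ^ i × Succeeds i σ y)
      -- All paths are finished, so any code would do.
      by-cases (yes k≤c) i i≤N le = 0 , m^n>0 B i , λ τ A _ →
        solveLoop-stays i τ (agree-good A Gσ) (≤-trans k≤c (≤-reflexive (AgreeOff.regsAgree A curR tt)))
      -- Without remaining steps the measure is 0, hence so is `k ∸ c`.
      by-cases (no k≰c) zero    i≤N le =
        contradiction (m∸n≡0⇒m≤n (m+n≡0⇒m≡0 (k ∸ regs σ curR) (n≤0⇒n≡0 le))) k≰c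
      by-cases (no k≰c) (suc i) i<N le =
        good-step i<N Gσ Sol le (≰⇒> k≰c) (solveLoop-complete i (<⇒≤ i<N))

-- Trying all sequences of choices

clearArrays : Loop
clearArrays = clear colA ▸ clear potA ▸ clear parA

clearRegs : Loop
clearRegs =
  (curR ← lit 0) ▸ (gR ← lit 0) ▸ (finR ← lit 0) ▸ (uR ← lit 0) ▸ (vR ← lit 0) ▸ (wR ← lit 0) ▸
  (clearC ← lit 0) ▸ (stepC ← lit 0) ▸ (edgeC ← lit 0) ▸ (roundC ← lit 0) ▸
  (digitC ← lit 0) ▸ (traceC ← lit 0)

-- Resetting even the registers that are written before they are read makes
-- all attempts start in states that agree off the volatile registers.
reset : Loop
reset = clearArrays ▸ clearRegs

report : Loop
report = If var kR ⊖ var curR Then pass Else (ansR ← lit 1)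

allSteps : Loop
allSteps = For stepC To stepsR Do oneStep

attempt : Loop
attempt = (codeR ← var codeC) ▸ reset ▸ allSteps ▸ report

main : Loop
main = (ansR ← lit 0) ▸ (For codeC To codesR Do attempt)

-- Registers 9 to 23 and arrays 3 to 5 are the working memory. Below them lie the input and the
-- results of the setup, above them the scratch registers of the setup.
untouched : Var → Bool
untouched r = (r <ᵇ 9) ∨ (23 <ᵇ r)

untouchedArr : Arr → Bool
untouchedArr a = (a <ᵇ 3) ∨ (5 <ᵇ a)

reset-agree : ∀ {σ τ} →
  (∀ r → T (untouched r) → regs σ r ≡ regs τ r) →
  (∀ a → T (untouchedArr a) → ∀ y → arrays σ a y ≡ arrays τ a y) →
  (∀ a → T (not (untouchedArr a)) → ∀ y → arrays (⟪ reset ⟫ σ) a y ≡ 0 × arrays (⟪ reset ⟫ τ) a y ≡ 0) →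
  AgreeOff volatile (⟪ reset ⟫ σ) (⟪ reset ⟫ τ)
reset-agree {σ} {τ} ra aa zeros = agree
  (λ { 0 _ → kept 0 tt ; 1 _ → kept 1 tt ; 2 _ → kept 2 tt ; 3 _ → kept 3 tt ; 4 _ → kept 4 tt
     ; 5 _ → kept 5 tt ; 6 _ → kept 6 tt ; 7 _ → kept 7 tt ; 8 _ → kept 8 tt
     ; 9 _ → refl ; 10 () ; 11 () ; 12 _ → refl ; 13 _ → refl ; 14 _ → refl ; 15 _ → refl
     ; 16 _ → refl ; 17 () ; 18 _ → refl ; 19 _ → refl ; 20 _ → refl ; (suc 20) _ → refl
     ; (suc (suc 20)) _ → refl ; (suc (suc (suc 20))) _ → refl
     ; r@(suc (suc (suc (suc (suc (suc (suc (suc (suc (suc (suc (suc (suc (suc (suc (suc (suc (suc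
         (suc (suc (suc (suc (suc (suc _)))))))))))))))))))))))) _ → kept r tt })
  (λ { 0 → keptArr 0 tt ; 1 → keptArr 1 tt ; 2 → keptArr 2 tt
     ; 3 → zeroed 3 tt ; 4 → zeroed 4 tt ; 5 → zeroed 5 tt
     ; a@(suc (suc (suc (suc (suc (suc _)))))) → keptArr a tt })
  where
  kept : ∀ r → T (untouched r) → regs (⟪ reset ⟫ σ) r ≡ regs (⟪ reset ⟫ τ) r
  kept r Lr = trans (keeps untouched Lr reset _ σ) (trans (ra r Lr) (sym (keeps untouched Lr reset _ τ)))
  keptArr : ∀ a → T (untouchedArr a) → ∀ y → arrays (⟪ reset ⟫ σ) a y ≡ arrays (⟪ reset ⟫ τ) a y
  keptArr a La y = trans (cong-app (keepsArr untouchedArr La reset _ σ) y)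
    (trans (aa a La y) (sym (cong-app (keepsArr untouchedArr La reset _ τ) y)))
  zeroed : ∀ a → T (not (untouchedArr a)) → ∀ y → arrays (⟪ reset ⟫ σ) a y ≡ arrays (⟪ reset ⟫ τ) a y
  zeroed a La y = trans (proj₁ (zeros a La y)) (sym (proj₂ (zeros a La y)))

in-sequence : ∀ p q r u σ → ⟪ p ▸ q ▸ r ▸ u ⟫ σ ≡ ⟪ u ⟫ (⟪ r ⟫ (⟪ q ⟫ (⟪ p ⟫ σ)))
in-sequence p q r u σ = refl

module Enumerating (G : Graph) (s t : Graph.Vertex G) (k ℓ : ℕ) (pw : ℕ → ℕ)
  (power : ∀ q → q < k * ℓ → pw q ≡ suc ((ℓ ∸ 1) * k) ^ q) where
  open Graph G
  open Solving G s t k ℓ pw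
  open Instance G s t k ℓ N B M pw
  open Planning G s t k ℓ N B M pw

  reset-zeros : ∀ {σ} → Good σ → ∀ a → T (not (untouchedArr a)) → ∀ y → arrays (⟪ reset ⟫ σ) a y ≡ 0
  reset-zeros {σ} (good S u b) = λ
    { 3 _ y → trans (cong-app (trans (keepsArr (only colA) {colA} tt clearRegs _ σ₃)
                (trans (keepsArr (only colA) {colA} tt (clear parA) _ σ₂)
                       (keepsArr (only colA) {colA} tt (clear potA) _ σ₁))) y)
                (zero-by-spec colA σ S (Blank.beyond b) y)
    ; 4 _ y → trans (cong-app (trans (keepsArr (only potA) {potA} tt clearRegs _ σ₃)
                (keepsArr (only potA) {potA} tt (clear parA) _ σ₂)) y)
                (zero-by-spec potA σ₁ S₁ (λ y n≤y → trans (cong-app (keepsArr (only potA) {potA} tt (clear colA) _ σ) y)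
                   (proj₁ (u y n≤y))) y)
    ; 5 _ y → trans (cong-app (keepsArr (only parA) {parA} tt clearRegs _ σ₃) y)
                (zero-by-spec parA σ₂ S₂ (λ y n≤y → trans (cong-app (trans
                   (keepsArr (only parA) {parA} tt (clear potA) _ σ₁)
                   (keepsArr (only parA) {parA} tt (clear colA) _ σ)) y) (proj₂ (u y n≤y))) y)
    ; 0 () ; 1 () ; 2 () ; (suc (suc (suc (suc (suc (suc _)))))) () }
    where
    σ₁ = ⟪ clear colA ⟫ σ
    S₁ = matches-kept (clear colA) _ _ {σ} S
    σ₂ = ⟪ clear potA ⟫ σ₁
    S₂ = matches-kept (clear potA) _ _ {σ₁} S₁
    σ₃ = ⟪ clear parA ⟫ σ₂
    zero-by-spec : ∀ a σ → Static σ → (∀ y → n ≤ y → arrays σ a y ≡ 0) → ∀ y →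
      arrays (⟪ clear a ⟫ σ) a y ≡ 0
    zero-by-spec a σ S beyond y with clear-spec a σ n (regsMatch S nR tt) | y <? n
    ... | below , _     | yes y<n = below y y<n
    ... | _     , above | no y≮n  = trans (above y (≮⇒≥ y≮n)) (beyond y (≮⇒≥ y≮n))

  reset-good : ∀ {σ} → Good σ → Good (⟪ reset ⟫ σ)
  reset-good {σ} Gσ = good (matches-kept reset _ _ {σ} (Good.static Gσ))
    (λ y _ → zeros potA tt y , zeros parA tt y)
    (blank (λ y _ → zeros colA tt y) (zeros colA tt _) (zeros colA tt _))
    where
    zeros = reset-zeros Gσ

  module _ (σ₀ : State) (G₀ : Good σ₀) where

    record Between (τ : State) : Set where
      field
        isGood     : Good τ
        regsKept   : ∀ r → T (untouched r) → regs σ₀ r ≡ regs τ r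
        arraysKept : ∀ a → T (untouchedArr a) → ∀ y → arrays σ₀ a y ≡ arrays τ a y

    open Between

    -- Off the volatile registers, the steps start from this state for every code. A successful code
    -- can thus be planned once, before the enumeration begins.
    canonical : State
    canonical = setReg stepC N (⟪ reset ⟫ σ₀)

    Success : ℕ → Set
    Success = Succeeds N canonical

    Witness : Set
    Witness = Σ[ col ∈ (ℕ → ℕ) ] Sound k col

    record Attempted (i : ℕ) (τ τ′ : State) : Set where
      field
        between  : Between τ′
        answer   : regs τ′ ansR ≡ regs τ ansR ⊎ (regs τ′ ansR ≡ 1 × Witness)
        complete : Success i → regs τ′ ansR ≡ 1

    report-spec : ∀ υ → Static υ →
      (k ≤ regs υ curR × ⟪ report ⟫ υ ≡ setReg ansR 1 υ) ⊎ (¬ k ≤ regs υ curR × ⟪ report ⟫ υ ≡ υ)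
    report-spec υ S with k ≤? regs υ curR
    ... | yes k≤c = inj₁ (k≤c , if-false (var kR ⊖ var curR) pass (ansR ← lit 1) υ
                      (m≤n⇒m∸n≡0 (≤-trans (≤-reflexive (regsMatch S kR tt)) k≤c)))
    ... | no k≰c  = inj₂ (k≰c , if-true (var kR ⊖ var curR) pass (ansR ← lit 1) υ
                      (λ ≡0 → k≰c (≤-trans (≤-reflexive (sym (regsMatch S kR tt))) (m∸n≡0⇒m≤n ≡0))))

    between-setReg : ∀ {τ} x v → T (not (x <ᵇ 9)) → T (not (untouched x)) → Between τ → Between (setReg x v τ)
    between-setReg {τ} x v x≥9 Ux Bτ = record
      { isGood     = good-setReg {τ} x v x≥9 (isGood Bτ)
      ; regsKept   = λ r Lr → trans (regsKept Bτ r Lr) (sym (update-other (regs τ) v (separated untouched {x} {r} Ux Lr)))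
      ; arraysKept = arraysKept Bτ }

    between-loop : ∀ {τ} p → Keeps untouched p → KeepsArr untouchedArr p → Good (⟪ p ⟫ τ) → Between τ →
      Between (⟪ p ⟫ τ)
    between-loop {τ} p K KA Gp Bτ = record
      { isGood     = Gp
      ; regsKept   = λ r Lr → trans (regsKept Bτ r Lr) (sym (keeps untouched Lr p K τ))
      ; arraysKept = λ a La y → trans (arraysKept Bτ a La y) (sym (cong-app (keepsArr untouchedArr La p KA τ) y)) }

    reset-canonical : ∀ {τ} → Between τ → AgreeOff volatile canonical (setReg stepC N (⟪ reset ⟫ τ))
    reset-canonical {τ} Bτ = agree-setReg {σ = ⟪ reset ⟫ σ₀} {⟪ reset ⟫ τ} stepC refl (reset-agree {σ₀} {τ} (regsKept Bτ) (arraysKept Bτ)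
      (λ a La y → reset-zeros {σ₀} G₀ a La y , reset-zeros {τ} (isGood Bτ) a La y))

    allSteps-run : ∀ {υ} → Good υ → ⟪ allSteps ⟫ υ ≡ solveLoop N (setReg stepC N υ)
    allSteps-run {υ} Gυ = cong (λ l → solveLoop l (setReg stepC l υ)) (regsMatch (Good.static Gυ) stepsR tt)

    allSteps-sound : ∀ {υ} → Good υ → regs υ curR ≡ 0 → StateSound (⟪ allSteps ⟫ υ)
    allSteps-sound {υ} Gυ cur≡0 = subst StateSound (sym (allSteps-run {υ} Gυ))
      (solveLoop-sound N (setReg stepC N υ) (good-setReg {υ} stepC N tt Gυ ,
        λ j j<c → contradiction (subst (toℕ j <_) cur≡0 j<c) n≮0))

    report-attempted : ∀ {i τ υ} → Between υ → StateSound υ → regs υ ansR ≡ regs τ ansR →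
      (Success i → k ≤ regs υ curR) → Attempted i τ (⟪ report ⟫ υ)
    report-attempted {i} {τ} {υ} Bυ Sυ ansKept succeeds = by-cases (report-spec υ (Good.static (proj₁ Sυ)))
      where
      by-cases : (k ≤ regs υ curR × ⟪ report ⟫ υ ≡ setReg ansR 1 υ) ⊎ (¬ k ≤ regs υ curR × ⟪ report ⟫ υ ≡ υ) →
        Attempted i τ (⟪ report ⟫ υ)
      by-cases (inj₁ (k≤c , eq)) = subst (Attempted i τ) (sym eq) (record
        { between  = between-setReg {υ} ansR 1 tt tt Bυ
        ; answer   = inj₂ (refl , arrays υ colA , λ j j<k → proj₂ Sυ j (≤-trans j<k k≤c))
        ; complete = λ _ → refl })
      by-cases (inj₂ (k≰c , eq)) = subst (Attempted i τ) (sym eq) (record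
        { between  = Bυ
        ; answer   = inj₁ ansKept
        ; complete = λ S → contradiction (succeeds S) k≰c })

    steps-attempted : ∀ {i τ υ} → Between υ → regs υ curR ≡ 0 → regs υ ansR ≡ regs τ ansR →
      (Success i → k ≤ regs (solveLoop N (setReg stepC N υ)) curR) →
      Attempted i τ (⟪ report ⟫ (⟪ allSteps ⟫ υ))
    steps-attempted {i} {τ} {υ} Bυ cur≡0 ansKept succeeds = report-attempted {i} {τ} {⟪ allSteps ⟫ υ}
      (between-loop {υ} allSteps _ _ (proj₁ Sυ) Bυ) Sυ
      (trans (keeps (only ansR) {ansR} tt allSteps _ υ) ansKept)
      (λ S → subst (λ ω → k ≤ regs ω curR) (sym (allSteps-run {υ} (isGood Bυ))) (succeeds S))
      where
      Sυ = allSteps-sound {υ} (isGood Bυ) cur≡0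

    cur-reset : ∀ τ → regs (⟪ reset ⟫ τ) curR ≡ 0
    cur-reset τ = refl

    reset-attempted : ∀ {i τ τ₁} → Between τ₁ → regs τ₁ ansR ≡ regs τ ansR → regs τ₁ codeR ≡ i →
      Attempted i τ (⟪ report ⟫ (⟪ allSteps ⟫ (⟪ reset ⟫ τ₁)))
    reset-attempted {i} {τ} {τ₁} Bτ₁ ansKept codeEq = steps-attempted {i} {τ} {⟪ reset ⟫ τ₁}
      (between-loop {τ₁} reset _ _ (reset-good {τ₁} (isGood Bτ₁)) Bτ₁) (cur-reset τ₁)
      (trans (keeps (only ansR) {ansR} tt reset _ τ₁) ansKept)
      (λ S → S (setReg stepC N (⟪ reset ⟫ τ₁)) (reset-canonical {τ₁} Bτ₁)
        (trans (keeps (only codeR) {codeR} tt reset _ τ₁) codeEq))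

    inlined-attempted : ∀ i τ → Between τ →
      Attempted i τ (⟪ (codeR ← var codeC) ▸ reset ▸ allSteps ▸ report ⟫ (setReg codeC i τ))
    inlined-attempted i τ Bτ = subst (Attempted i τ)
      (sym (in-sequence (codeR ← var codeC) reset allSteps report (setReg codeC i τ)))
      (reset-attempted {i} {τ} {⟪ codeR ← var codeC ⟫ (setReg codeC i τ)} Bτ₁ refl refl)
      where
      Bτ₁ : Between (⟪ codeR ← var codeC ⟫ (setReg codeC i τ))
      Bτ₁ = between-setReg {setReg codeC i τ} codeR i tt tt (between-setReg {τ} codeC i tt tt Bτ)

    -- The subst is along an equation between programs: comparing their
    -- denotations directly would unfold both.
    attempt-spec : ∀ i τ → Between τ → Attempted i τ (⟪ attempt ⟫ (setReg codeC i τ))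
    attempt-spec i τ Bτ = subst (λ p → Attempted i τ (⟪ p ⟫ (setReg codeC i τ)))
      {(codeR ← var codeC) ▸ reset ▸ allSteps ▸ report} {attempt} refl (inlined-attempted i τ Bτ)

    -- Codes are counted down, so `i ≤ y` says that `y` has been tried. Both directions are carried
    -- along: an answer 1 comes with a colouring, and a successful code that has been tried forces
    -- the answer 1.
    MainInv : ℕ → State → Set
    MainInv i τ = Between τ × (regs τ ansR ≡ 0 ⊎ (regs τ ansR ≡ 1 × Witness)) ×
        (∀ y → y < M → Success y → i ≤ y → regs τ ansR ≡ 1)

    attempted-inv : ∀ {i τ τ′} → MainInv (suc i) τ → Attempted i τ τ′ → MainInv i τ′
    attempted-inv {i} {τ} {τ′} (Bτ , ans , succ) A = between , answer′ ans answer , λ y y<M S i≤y → succ′ y y<M S i≤y (i ≟ y)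
        where
        open Attempted A
        answer′ : regs τ ansR ≡ 0 ⊎ (regs τ ansR ≡ 1 × Witness) →
          regs τ′ ansR ≡ regs τ ansR ⊎ (regs τ′ ansR ≡ 1 × Witness) →
          regs τ′ ansR ≡ 0 ⊎ (regs τ′ ansR ≡ 1 × Witness)
        answer′ _                  (inj₂ yes′) = inj₂ yes′
        answer′ (inj₁ ≡0)          (inj₁ eq)   = inj₁ (trans eq ≡0)
        answer′ (inj₂ (≡1 , wit))  (inj₁ eq)   = inj₂ (trans eq ≡1 , wit)
        stays : regs τ ansR ≡ 1 → regs τ′ ansR ≡ regs τ ansR ⊎ (regs τ′ ansR ≡ 1 × Witness) →
          regs τ′ ansR ≡ 1
        stays ≡1 (inj₁ eq)       = trans eq ≡1
        stays ≡1 (inj₂ (≡1′ , _)) = ≡1′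
        succ′ : ∀ y → y < M → Success y → i ≤ y → Dec (i ≡ y) → regs τ′ ansR ≡ 1
        succ′ y y<M S i≤y (yes refl) = complete S
        succ′ y y<M S i≤y (no i≢y)   = stays (succ y y<M S (≤∧≢⇒< i≤y i≢y)) answer

    attempt-inv : ∀ i τ → i < M → MainInv (suc i) τ → MainInv i (⟪ attempt ⟫ (setReg codeC i τ))
    attempt-inv i τ i<M Iτ = attempted-inv {i} {τ} {⟪ attempt ⟫ (setReg codeC i τ)} Iτ (attempt-spec i τ (proj₁ Iτ))

    attempts-inv : ∀ υ → Between υ → regs υ ansR ≡ 0 →
      MainInv 0 (countdown (λ i τ → ⟪ attempt ⟫ (setReg codeC i τ)) M (setReg codeC M υ))
    attempts-inv υ Bυ ans≡0 =
      countdown-invariant MainInv (λ i τ → ⟪ attempt ⟫ (setReg codeC i τ)) M attempt-inv (setReg codeC M υ)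
        (between-setReg {υ} codeC M tt tt Bυ , inj₁ ans≡0 , λ y y<M _ M≤y → contradiction y<M (≤⇒≯ M≤y))

    main-inv : MainInv 0 (⟪ main ⟫ σ₀)
    main-inv = subst (λ l → MainInv 0 (countdown (λ i τ → ⟪ attempt ⟫ (setReg codeC i τ)) l (setReg codeC l σ₁)))
      {M} {regs σ₁ codesR} (sym (regsMatch (Good.static G₀) codesR tt))
      (attempts-inv σ₁ (between-setReg {σ₀} ansR 0 tt tt record
        { isGood = G₀ ; regsKept = λ _ _ → refl ; arraysKept = λ _ _ _ → refl }) refl)
      where
      σ₁ = ⟪ ansR ← lit 0 ⟫ σ₀

    main-sound : let τ = ⟪ main ⟫ σ₀ in regs τ ansR ≡ 0 ⊎ (regs τ ansR ≡ 1 × Witness)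
    main-sound = proj₁ (proj₂ main-inv)

    main-complete : 1 ≤ ℓ → (X : Fin k → List Vertex) → Solution 0 (λ _ → 0) X →
      regs (⟪ main ⟫ σ₀) ansR ≡ 1
    main-complete 1≤ℓ X Sol =
      let y , y<M , S = solveLoop-complete power N ≤-refl canonical X Gc Sol′ (measure-bound Sol′ 1≤ℓ)
      in proj₂ (proj₂ main-inv) y y<M S z≤n
      where
      Gc : Good canonical
      Gc = good-setReg {⟪ reset ⟫ σ₀} stepC N tt (reset-good {σ₀} G₀)
      Sol′ : Solution (regs canonical curR) (arrays canonical colA) X
      Sol′ = record { Solution Sol ; coloured = λ _ _ _ _ → inj₁ (reset-zeros {σ₀} G₀ colA tt _) }

-- Packings and colourings

module Packing (G : Graph) (s t : Graph.Vertex G) (k ℓ : ℕ) (pw : ℕ → ℕ) where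
  open Graph G
  open Solving G s t k ℓ pw
  open Tracing G s t k ℓ N B M pw
  open Planning G s t k ℓ N B M pw

  last-∷ : ∀ (x y : Vertex) ys → List⁺.last (x List⁺.∷ y ∷ ys) ≡ List⁺.last (y List⁺.∷ ys)
  last-∷ x y ys with initLast ys
  ... | []       = refl
  ... | zs ∷ʳ′ z = refl

  chain-linked : ∀ {v ws} → Chain v ws → Linked _~_ (v ∷ ws)
  chain-linked end              = [-]
  chain-linked (v~w ∷ C)        = v~w ∷ chain-linked C

  chain-last : ∀ {v ws} → Chain v ws → List⁺.last (v List⁺.∷ ws) ≡ t
  chain-last end                             = refl
  chain-last {v} (_∷_ {w = w} {ws} _ C) = trans (last-∷ v w ws) (chain-last C)

  chain-t : ∀ {v ws} → Chain v ws → t ∈ v ∷ ws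
  chain-t end     = here refl
  chain-t (_ ∷ C) = there (chain-t C)

  linked-chain : ∀ {v ws} → Linked _~_ (v ∷ ws) → List⁺.last (v List⁺.∷ ws) ≡ t → Chain v ws
  linked-chain [-] refl = end
  linked-chain {v} (_∷_ {y = w} {xs = ws} v~w L) eq = v~w ∷ linked-chain L (trans (sym (last-∷ v w ws)) eq)

  sound⇒packing : ∀ {col} → Sound k col → ShortPathPacking G s t k ℓ
  sound⇒packing {col} S = P ,
    (λ j → let _ , C , U , _ = S j (toℕ<n j) in record
       { distinct = U ; adjacent = chain-linked C ; first = refl ; last = chain-last C }) ,
    (λ i j i≢j v → mk⇔ (λ (v∈i , v∈j) → shared i j i≢j v∈i v∈j)
       λ { (inj₁ refl) → here refl , here refl
         ; (inj₂ refl) → t∈ i , t∈ j }) ,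
    λ j → proj₁ (proj₂ (proj₂ (proj₂ (S j (toℕ<n j)))))
    where
    ws : Fin k → List Vertex
    ws j = proj₁ (S j (toℕ<n j))
    P : Fin k → List⁺ Vertex
    P j = s List⁺.∷ ws j
    t∈ : ∀ j → t ∈ s ∷ ws j
    t∈ j = chain-t (proj₁ (proj₂ (S j (toℕ<n j))))
    colourOf : ∀ j {v} → v ∈ ws j → v ≢ t → col (toℕ v) ≡ suc (toℕ j)
    colourOf j = proj₂ (proj₂ (proj₂ (proj₂ (S j (toℕ<n j)))))
    shared : ∀ i j → i ≢ j → ∀ {v} → v ∈ s ∷ ws i → v ∈ s ∷ ws j → v ≡ s ⊎ v ≡ t
    shared i j i≢j (here v≡s) _ = inj₁ v≡s
    shared i j i≢j (there _) (here v≡s) = inj₁ v≡s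
    shared i j i≢j {v} (there v∈i) (there v∈j) with v Fin.≟ t
    ... | yes v≡t = inj₂ v≡t
    ... | no v≢t = contradiction
      (toℕ-injective (suc-injective (trans (sym (colourOf i v∈i v≢t)) (colourOf j v∈j v≢t)))) i≢j

  -- Dropping the first vertex of a path makes the length of the list equal to the length of the
  -- path.
  packing⇒solution : ShortPathPacking G s t k ℓ →
    Σ[ X ∈ (Fin k → List Vertex) ] Solution 0 (λ _ → 0) X
  packing⇒solution (P , isPath , disj , short) = (λ j → List⁺.tail (P j)) , record
    { chain    = chain
    ; short    = short
    ; disjoint = λ i j i≢j v∈i v∈j → Equivalence.to (disj i j i≢j _) (there v∈i , there v∈j)
    ; coloured = λ _ _ _ _ → inj₁ refl }
    where
    chain : ∀ j → Chain s (List⁺.tail (P j))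
    chain j with P j | isPath j
    ... | v List⁺.∷ ws | record { adjacent = L ; first = refl ; last = eq } = linked-chain L eq

-- The number of steps, the base and its powers, without multiplication

accumulate : Var → Var → Var → Expr → Loop
accumulate r x y e = For r To x Do (y ← var y ⊕ e)

-- Repeated addition in place of a product; the last premise ensures that every round adds the same
-- amount `v`.
accumulate-spec : ∀ r x y e σ {v} → r ≢ y →
  (∀ τ → (∀ z → r ≢ z → y ≢ z → regs τ z ≡ regs σ z) → ⟦ e ⟧ τ ≡ v) →
  regs (⟪ accumulate r x y e ⟫ σ) y ≡ regs σ y + regs σ x * v
accumulate-spec r x y e σ {v} r≢y stable =
  trans (sym (+-identityʳ _)) (proj₂ final)
  where
  I : ℕ → State → Set
  I i τ = (∀ z → r ≢ z → y ≢ z → regs τ z ≡ regs σ z) ×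
    regs τ y + i * v ≡ regs σ y + regs σ x * v
  body : ∀ i τ → i < regs σ x → I (suc i) τ → I i (⟪ y ← var y ⊕ e ⟫ (setReg r i τ))
  body i τ _ (same , eq) =
    (λ z r≢z y≢z → trans (update-other (regs (setReg r i τ)) _ y≢z) (same′ z r≢z y≢z)) ,
    trans (cong (_+ i * v) (trans (update-same (regs (setReg r i τ)) y _)
             (cong₂ _+_ (update-other (regs τ) i r≢y) (stable (setReg r i τ) same′))))
          (trans (+-assoc (regs τ y) v (i * v)) eq)
    where
    same′ : ∀ z → r ≢ z → y ≢ z → regs (setReg r i τ) z ≡ regs σ z
    same′ z r≢z y≢z = trans (update-other (regs τ) i r≢z) (same z r≢z y≢z)
  final : I 0 (⟪ accumulate r x y e ⟫ σ)
  final = countdown-invariant I (λ i τ → ⟪ y ← var y ⊕ e ⟫ (setReg r i τ)) (regs σ x) body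
    (setReg r (regs σ x) σ)
    ((λ z r≢z _ → update-other (regs σ) _ r≢z) , cong (_+ _) (update-other (regs σ) _ r≢y))

setupSizes : Loop
setupSizes =
  accumulate setupC kR stepsR (var ℓR) ▸ (digitsR ← lit 1) ▸
  accumulate setupC kR digitsR (var ℓR ⊖ lit 1)

-- The counter runs down from `N ∸ 1`, so the reversed index fills the table upwards. Meanwhile
-- `codesR` grows by the factor `B` per round and ends as the number of codes `B ^ N`.
storePower : Loop
storePower =
  (powA [ (var stepsR ⊖ lit 1) ⊖ var setupC ]← var codesR) ▸ (sumR ← lit 0) ▸
  accumulate powerC digitsR sumR (var codesR) ▸ (codesR ← var sumR)

setupPowers : Loop
setupPowers = (codesR ← lit 1) ▸ (For setupC To stepsR Do storePower)

setupSizes-spec : ∀ σ → regs σ stepsR ≡ 0 →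
  regs (⟪ setupSizes ⟫ σ) stepsR ≡ regs σ kR * regs σ ℓR ×
  regs (⟪ setupSizes ⟫ σ) digitsR ≡ suc (regs σ kR * (regs σ ℓR ∸ 1))
setupSizes-spec σ ≡0 =
  trans (keeps (only stepsR) {stepsR} tt (accumulate setupC kR digitsR (var ℓR ⊖ lit 1)) _ σ₂)
    (trans (accumulate-spec setupC kR stepsR (var ℓR) σ (λ ()) (λ τ same → same ℓR (λ ()) (λ ())))
      (cong (_+ regs σ kR * regs σ ℓR) ≡0)) ,
  trans (accumulate-spec setupC kR digitsR (var ℓR ⊖ lit 1) σ₂ {regs σ ℓR ∸ 1} (λ ())
          (λ τ same → cong (_∸ 1) (trans (same ℓR (λ ()) (λ ()))
             (keeps (only ℓR) {ℓR} tt (accumulate setupC kR stepsR (var ℓR)) _ σ))))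
    (cong (λ x → suc (x * (regs σ ℓR ∸ 1)))
      (keeps (only kR) {kR} tt (accumulate setupC kR stepsR (var ℓR)) _ σ))
  where
  σ₂ = ⟪ digitsR ← lit 1 ⟫ (⟪ accumulate setupC kR stepsR (var ℓR) ⟫ σ)

setupPowers-spec : ∀ σ {N B} → regs σ stepsR ≡ N → regs σ digitsR ≡ B →
  regs (⟪ setupPowers ⟫ σ) codesR ≡ B ^ N ×
  (∀ q → q < N → arrays (⟪ setupPowers ⟫ σ) powA q ≡ B ^ q)
setupPowers-spec σ {N} {B} refl refl = proj₁ (proj₂ (proj₂ final)) , proj₂ (proj₂ (proj₂ final))
  where
  I : ℕ → State → Set
  I i τ = regs τ stepsR ≡ N × regs τ digitsR ≡ B × regs τ codesR ≡ B ^ (N ∸ i) ×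
    (∀ q → q < N ∸ i → arrays τ powA q ≡ B ^ q)
  body : ∀ i τ → i < N → I (suc i) τ → I i (⟪ storePower ⟫ (setReg setupC i τ))
  body i τ i<N (stepsEq , digitsEq , codesEq , pows) =
    trans (keeps (only stepsR) {stepsR} tt storePower _ (setReg setupC i τ)) stepsEq ,
    trans (keeps (only digitsR) {digitsR} tt storePower _ (setReg setupC i τ)) digitsEq ,
    trans (accumulate-spec powerC digitsR sumR (var codesR) τ₂ (λ ()) (λ υ same → same codesR (λ ()) (λ ())))
      (trans (cong₂ _*_ digitsEq codesEq) (cong (B ^_) top)) ,
    λ q q< → trans (cong-app (keepsArr (only powA) {powA} tt (accumulate powerC digitsR sumR (var codesR)) _ τ₂) q)
      (stored q (subst (q <_) (sym top) q<) (q ≟ N ∸ suc i))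
    where
    τ₁ = ⟪ powA [ (var stepsR ⊖ lit 1) ⊖ var setupC ]← var codesR ⟫ (setReg setupC i τ)
    τ₂ = ⟪ sumR ← lit 0 ⟫ τ₁
    top : suc (N ∸ suc i) ≡ N ∸ i
    top = sym (+-∸-assoc 1 i<N)
    index : regs τ stepsR ∸ 1 ∸ i ≡ N ∸ suc i
    index = trans (cong (λ x → x ∸ 1 ∸ i) stepsEq) (∸-+-assoc N 1 i)
    stored : ∀ q → q < suc (N ∸ suc i) → Dec (q ≡ N ∸ suc i) → arrays τ₁ powA q ≡ B ^ q
    stored q q< (yes refl) = trans (cong (λ j → (arrays τ powA [ j ↦ regs τ codesR ]) q) index)
      (trans (update-same (arrays τ powA) q (regs τ codesR)) codesEq)
    stored q q< (no q≢) = trans (cong (λ j → (arrays τ powA [ j ↦ regs τ codesR ]) q) index)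
      (trans (update-other (arrays τ powA) (regs τ codesR) (λ eq → q≢ (sym eq)))
             (pows q (≤∧≢⇒< (≤-pred q<) q≢)))
  final : I 0 (⟪ setupPowers ⟫ σ)
  final = countdown-invariant I (λ i τ → ⟪ storePower ⟫ (setReg setupC i τ)) N body
    (setReg setupC N (⟪ codesR ← lit 1 ⟫ σ))
    (refl , refl , cong (B ^_) (sym (n∸n≡0 N)) , λ q q< → contradiction (subst (q <_) (n∸n≡0 N) q<) n≮0)

-- Estimating the running time

factor : Loop → ℕ
factor pass                 = 1
factor (x ← e)              = 1 + cost e
factor (a [ e ]← f)         = 1 + cost e + cost f
factor (p ▸ q)              = factor p + factor q
factor (If e Then p Else q) = 1 + cost e + (factor p + factor q)
factor (For r To x Do p)    = 10 + factor p

-- A hierarchy of budgets: a loop with budget `D` grants its body a budget `D′` such that all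
-- iterations together stay within `D`.
Fits : (Var → ℕ) → Loop → ℕ → Set
Fits ρ pass                 D = ⊤
Fits ρ (x ← e)              D = ⊤
Fits ρ (a [ e ]← f)         D = ⊤
Fits ρ (p ▸ q)              D = Fits ρ p D × Fits ρ q D
Fits ρ (If e Then p Else q) D = Fits ρ p D × Fits ρ q D
Fits ρ (For r To x Do p)    D = Σ[ D′ ∈ ℕ ] (1 ≤ D′ × ρ x * D′ ≤ D × Fits ρ p D′)

-- Positive budgets absorb all additive constants into `factor`, which depends on the text alone.
-- The summand 10 of a loop is 4 for entry and exit plus 6 per iteration.
time-fits : ∀ ρ p {D} → 1 ≤ D → Fits ρ p D → time ρ p ≤ factor p * D
time-fits ρ pass         {suc D} _ F = s≤s z≤n
time-fits ρ (x ← e)      {suc D} _ F = m≤m*n (1 + cost e) (suc D)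
time-fits ρ (a [ e ]← f) {suc D} _ F = m≤m*n (1 + cost e + cost f) (suc D)
time-fits ρ (p ▸ q)      {D} 1≤D (Fp , Fq) =
  ≤-trans (+-mono-≤ (time-fits ρ p 1≤D Fp) (time-fits ρ q 1≤D Fq))
          (≤-reflexive (sym (*-distribʳ-+ D (factor p) (factor q))))
time-fits ρ (If e Then p Else q) {suc D} 1≤D (Fp , Fq) = begin
  c + (time ρ p + time ρ q)             ≤⟨ +-mono-≤ (m≤m*n c (suc D)) (+-mono-≤ (time-fits ρ p 1≤D Fp) (time-fits ρ q 1≤D Fq)) ⟩
  c * suc D + (factor p * suc D + factor q * suc D)
                                        ≡⟨ cong (c * suc D +_) (sym (*-distribʳ-+ (suc D) (factor p) (factor q))) ⟩
  c * suc D + (factor p + factor q) * suc D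
                                        ≡⟨ sym (*-distribʳ-+ (suc D) c (factor p + factor q)) ⟩
  (c + (factor p + factor q)) * suc D   ∎
  where open ≤-Reasoning
        c = 1 + cost e
time-fits ρ (For r To x Do p) {suc D} 1≤D (suc D′ , 1≤D′ , le , Fp) = begin
  4 + ρ x * (6 + time ρ p)                  ≤⟨ +-mono-≤ (m≤m*n 4 (suc D)) (*-monoʳ-≤ (ρ x) inner) ⟩
  4 * suc D + ρ x * ((6 + factor p) * suc D′) ≡⟨ cong (4 * suc D +_) (swap-factors (ρ x) (6 + factor p) (suc D′)) ⟩
  4 * suc D + (6 + factor p) * (ρ x * suc D′) ≤⟨ +-monoʳ-≤ (4 * suc D) (*-monoʳ-≤ (6 + factor p) le) ⟩
  4 * suc D + (6 + factor p) * suc D        ≡⟨ sym (*-distribʳ-+ (suc D) 4 (6 + factor p)) ⟩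
  (10 + factor p) * suc D ∎
  where
  open ≤-Reasoning
  inner : 6 + time ρ p ≤ (6 + factor p) * suc D′
  inner = ≤-trans (+-mono-≤ (m≤m*n 6 (suc D′)) (time-fits ρ p 1≤D′ Fp))
                  (≤-reflexive (sym (*-distribʳ-+ (suc D′) 6 (factor p))))
  swap-factors : ∀ a b c → a * (b * c) ≡ b * (a * c)
  swap-factors = solve 3 (λ a b c → a :* (b :* c) := b :* (a :* c)) refl
    where open +-*-Solver

square≤2^ : ∀ x → x * x ≤ 3 * 2 ^ x
square≤2^ x = ≤-trans (≤-trans (m≤m+n (x * x) (2 * x + 3)) (≤-reflexive (sym (+-assoc (x * x) (2 * x) 3)))) (go x)
  where
  -- x² + 2x + 3 at most doubles from x to x + 1.
  go : ∀ x → x * x + 2 * x + 3 ≤ 3 * 2 ^ x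
  go zero    = ≤-refl
  go (suc x) = begin
    suc x * suc x + 2 * suc x + 3     ≤⟨ m≤m+n _ (x * x) ⟩
    suc x * suc x + 2 * suc x + 3 + x * x
      ≡⟨ solve 1 (λ x → (con 1 :+ x) :* (con 1 :+ x) :+ con 2 :* (con 1 :+ x) :+ con 3 :+ x :* x
                    := con 2 :* (x :* x :+ con 2 :* x :+ con 3)) refl x ⟩
    2 * (x * x + 2 * x + 3)           ≤⟨ *-monoʳ-≤ 2 (go x) ⟩
    2 * (3 * 2 ^ x)                   ≡⟨ solve 1 (λ y → con 2 :* (con 3 :* y) := con 3 :* (con 2 :* y)) refl (2 ^ x) ⟩
    3 * 2 ^ suc x ∎
    where open ≤-Reasoning
          open +-*-Solver

square≤self^ : ∀ x → 1 ≤ x → x * x ≤ x ^ x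
square≤self^ 1             _ = ≤-refl
square≤self^ x@(suc (suc _)) _ = ≤-trans (≤-reflexive (cong (x *_) (sym (*-identityʳ x))))
                                         (^-monoʳ-≤ x {2} {x} (s≤s (s≤s z≤n)))

*-^ : ∀ i x y → (x * y) ^ i ≡ x ^ i * y ^ i
*-^ zero    x y = refl
*-^ (suc i) x y = trans (cong (x * y *_) (*-^ i x y)) ([m*n]*[o*p]≡[m*o]*[n*p] x y (x ^ i) (y ^ i))

digits≤steps : ∀ k ℓ → 1 ≤ k → 1 ≤ ℓ → suc ((ℓ ∸ 1) * k) ≤ k * ℓ
digits≤steps k (suc ℓ) 1≤k _ = ≤-trans (+-monoˡ-≤ (ℓ * k) 1≤k) (≤-reflexive (*-comm (suc ℓ) k))

-- With `N = k * ℓ` the right side is `3 * (N ^ N * ℓ ^ N)`. The codes take up `N ^ N`, and for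
-- `ℓ ≥ 2` the factor `3 * ℓ ^ N` has room for the polynomial `N * N`. For `ℓ = 1` that room
-- vanishes, but then `B = 1` and `k * k ≤ k ^ k` suffices.
codes-bound : ∀ k ℓ → 1 ≤ k → 1 ≤ ℓ →
  suc ((ℓ ∸ 1) * k) ^ (k * ℓ) * (k * ℓ * (k * ℓ)) ≤ 3 * (k * ℓ ^ 2) ^ (k * ℓ)
codes-bound k 1 1≤k _ rewrite *-identityʳ k | ^-zeroˡ k | +-identityʳ (k * k) =
  ≤-trans (square≤self^ k 1≤k) (m≤n*m (k ^ k) 3)
codes-bound k ℓ@(suc (suc _)) 1≤k 1≤ℓ = begin
  suc ((ℓ ∸ 1) * k) ^ N * (N * N)  ≤⟨ *-mono-≤ (^-monoˡ-≤ N (digits≤steps k ℓ 1≤k 1≤ℓ)) (square≤2^ N) ⟩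
  N ^ N * (3 * 2 ^ N)              ≤⟨ *-monoʳ-≤ (N ^ N) (*-monoʳ-≤ 3 (^-monoˡ-≤ N (s≤s (s≤s z≤n)))) ⟩
  N ^ N * (3 * ℓ ^ N)              ≡⟨ solve 2 (λ a b → a :* (con 3 :* b) := con 3 :* (a :* b)) refl (N ^ N) (ℓ ^ N) ⟩
  3 * (N ^ N * ℓ ^ N)              ≡⟨ cong (3 *_) (sym (*-^ N N ℓ)) ⟩
  3 * (N * ℓ) ^ N                  ≡⟨ cong (λ x → 3 * x ^ N) (trans (*-assoc k ℓ ℓ) (cong (λ x → k * (ℓ * x)) (sym (*-identityʳ ℓ)))) ⟩
  3 * (k * ℓ ^ 2) ^ N ∎
  where open ≤-Reasoning
        open +-*-Solver
        N = k * ℓ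

-- The whole program

answer : Loop
answer = nR ← var ansR

answer-answers : ∀ τ {Q : Set} → (regs τ ansR ≡ 1 × Q) ⊎ (regs τ ansR ≡ 0 × ¬ Q) →
  Answers (⟪ answer ⟫ τ) Q
answer-answers τ decided = decided

solver : Program
solver = compile setupSizes ⨾ compile setupPowers ⨾ compile main ⨾ compile answer

constant : ℕ
constant = factor setupSizes + (factor setupPowers + (factor main + factor answer))

module Correctness (G : Graph) (s t : Graph.Vertex G) (k ℓ : ℕ) (1≤k : 1 ≤ k) (1≤ℓ : 1 ≤ ℓ) where
  open Graph G

  σᵢ σₛ σ₀ : State
  σᵢ = input G s t k ℓ
  σₛ = ⟪ setupSizes ⟫ σᵢ
  σ₀ = ⟪ setupPowers ⟫ σₛ

  pw : ℕ → ℕ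
  pw = arrays σ₀ powA

  open Solving G s t k ℓ pw using (N; B; M; Good; good; blank; Static)
  open Packing G s t k ℓ pw
  open Instance G s t k ℓ N B M pw using (ρ₀)

  sizes : regs σₛ stepsR ≡ N × regs σₛ digitsR ≡ B
  sizes = let stepsEq , digitsEq = setupSizes-spec σᵢ refl in
    stepsEq , trans digitsEq (cong suc (*-comm k (ℓ ∸ 1)))

  powers : regs σ₀ codesR ≡ M × (∀ q → q < N → pw q ≡ B ^ q)
  powers = setupPowers-spec σₛ (proj₁ sizes) (proj₂ sizes)

  kept : ∀ {x} → T (x <ᵇ 6) → regs σ₀ x ≡ regs σᵢ x
  kept x<6 = trans (keeps (_<ᵇ 6) x<6 setupPowers _ σₛ) (keeps (_<ᵇ 6) x<6 setupSizes _ σᵢ)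

  keptArr : ∀ a → T (not (a ≡ᵇ powA)) → arrays σ₀ a ≡ arrays σᵢ a
  keptArr a a≢pow = trans (keepsArr (λ b → not (b ≡ᵇ powA)) a≢pow setupPowers _ σₛ)
                          (keepsArr (λ b → not (b ≡ᵇ powA)) a≢pow setupSizes _ σᵢ)

  static : Static σ₀
  static = matches
    (λ { 0 _ → kept {0} tt ; 1 _ → kept {1} tt ; 2 _ → kept {2} tt
       ; 3 _ → kept {3} tt ; 4 _ → kept {4} tt ; 5 _ → kept {5} tt
       ; 6 _ → trans (keeps (only stepsR) {stepsR} tt setupPowers _ σₛ) (proj₁ sizes)
       ; 7 _ → trans (keeps (only digitsR) {digitsR} tt setupPowers _ σₛ) (proj₂ sizes)
       ; 8 _ → proj₁ powers
       ; (suc (suc (suc (suc (suc (suc (suc (suc (suc _))))))))) () })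
    (λ { 0 _ y → cong-app (keptArr 0 tt) y ; 1 _ y → cong-app (keptArr 1 tt) y ; 2 _ y → refl
       ; (suc (suc (suc _))) () })

  G₀ : Good σ₀
  G₀ = good static
    (λ y _ → cong-app (keptArr potA tt) y , cong-app (keptArr parA tt) y)
    (blank (λ y _ → cong-app (keptArr colA tt) y) (cong-app (keptArr colA tt) _) (cong-app (keptArr colA tt) _))

  open Enumerating G s t k ℓ pw (proj₂ powers)

  answers : Answers (⟪ answer ⟫ (⟪ main ⟫ σ₀)) (ShortPathPacking G s t k ℓ)
  answers = answer-answers (⟪ main ⟫ σ₀) (decided (main-sound σ₀ G₀))
    where
    decided : regs (⟪ main ⟫ σ₀) ansR ≡ 0 ⊎ (regs (⟪ main ⟫ σ₀) ansR ≡ 1 × Witness σ₀ G₀) →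
      (regs (⟪ main ⟫ σ₀) ansR ≡ 1 × ShortPathPacking G s t k ℓ) ⊎
      (regs (⟪ main ⟫ σ₀) ansR ≡ 0 × ¬ ShortPathPacking G s t k ℓ)
    decided (inj₂ (≡1 , w@(_ , S))) = inj₁ (≡1 , sound⇒packing {proj₁ w} S)
    decided (inj₁ ≡0) = inj₂ (≡0 , λ packing → let X , Sol = packing⇒solution packing in
      1+n≢0 (trans (sym (main-complete σ₀ G₀ 1≤ℓ X Sol)) ≡0))

  -- `D` multiplies the number of codes, the steps for each, a bound `N` on the `ℓ` rounds of a
  -- search, and `V` for the edges of a round. `V` also covers clearing an array, and is positive
  -- because `s` is a vertex.
  V D : ℕ
  V = n + m
  D = M * (N * (N * V))

  1≤V : 1 ≤ V
  1≤V = ≤-trans (≤-trans (s≤s z≤n) (toℕ<n s)) (m≤m+n n m)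

  1≤N : 1 ≤ N
  1≤N = *-mono-≤ 1≤k 1≤ℓ

  1≤M : 1 ≤ M
  1≤M = m^n>0 B N

  _≤*_ : ∀ {a b c} → 1 ≤ b → a ≤ c → a ≤ b * c
  _≤*_ {a} 1≤b a≤c = ≤-trans (≤-reflexive (sym (*-identityˡ a))) (*-mono-≤ 1≤b a≤c)

  1≤NV : 1 ≤ N * V
  1≤NV = *-mono-≤ 1≤N 1≤V

  1≤NNV : 1 ≤ N * (N * V)
  1≤NNV = *-mono-≤ 1≤N 1≤NV

  1≤D : 1 ≤ D
  1≤D = *-mono-≤ 1≤M 1≤NNV

  N≤NV : N ≤ N * V
  N≤NV = ≤-trans (≤-reflexive (sym (*-identityʳ N))) (*-monoʳ-≤ N 1≤V)

  k≤N : k ≤ N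
  k≤N = ≤-trans (≤-reflexive (sym (*-identityʳ k))) (*-monoʳ-≤ k 1≤ℓ)

  ℓ≤N : ℓ ≤ N
  ℓ≤N = ≤-trans (≤-reflexive (sym (*-identityˡ ℓ))) (*-monoˡ-≤ ℓ 1≤k)

  B≤N : B ≤ N
  B≤N = digits≤steps k ℓ 1≤k 1≤ℓ

  *1≤ : ∀ {a b} → a ≤ b → a * 1 ≤ b
  *1≤ {a} a≤b = ≤-trans (≤-reflexive (*-identityʳ a)) a≤b

  n≤NV : n ≤ N * V
  n≤NV = 1≤N ≤* m≤m+n n m

  fits-clear : ∀ a {D} → n ≤ D → Fits (ρ₀ 0) (clear a) D
  fits-clear a n≤D = 1 , ≤-refl , *1≤ n≤D , tt

  fits-setupSizes : Fits (regs σᵢ) setupSizes D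
  fits-setupSizes = looping , tt , looping
    where
    looping : Σ[ D′ ∈ ℕ ] (1 ≤ D′ × k * D′ ≤ D × ⊤)
    looping = 1 , ≤-refl , *1≤ (1≤M ≤* (1≤N ≤* ≤-trans k≤N N≤NV)) , tt

  fits-setupPowers : Fits (regs σₛ) setupPowers D
  fits-setupPowers = tt , N , 1≤N ,
    ≤-trans (≤-reflexive (cong (_* N) (proj₁ sizes))) (1≤M ≤* *-monoʳ-≤ N N≤NV) ,
    tt , tt , (1 , ≤-refl , ≤-trans (≤-reflexive (cong (_* 1) (proj₂ sizes))) (*1≤ B≤N) , tt) , tt

  -- The budgets are `N * (N * V)` per code, `N * V` per step and `V` per round of relaxation.
  -- Extracting a digit takes `B ≤ N` rounds and tracing a path `ℓ ≤ N`, both within the budget of a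
  -- step.
  fits-main : Fits (ρ₀ 0) main D
  fits-main = tt , N * (N * V) , 1≤NNV , ≤-refl ,
    (tt ,
     ((fits-clear colA n≤ , fits-clear potA n≤ , fits-clear parA n≤) , _) ,
     (N * V , 1≤NV , ≤-refl ,
       ((fits-clear potA n≤NV , tt ,
         (V , 1≤V , *-monoˡ-≤ V ℓ≤N , 1 , ≤-refl , *1≤ (m≤n+m m n) , _)) ,
        (tt , (1 , ≤-refl , *1≤ (≤-trans B≤N N≤NV) , _)) ,
        ((tt , tt , (1 , ≤-refl , *1≤ (≤-trans ℓ≤N N≤NV) , _) , tt) , tt)) ,
       tt) ,
     _)
    where
    n≤ : n ≤ N * (N * V)
    n≤ = 1≤N ≤* n≤NV

  run : Runs solver σᵢ (⟪ answer ⟫ (⟪ main ⟫ σ₀)) (constant * D)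
  run = record { run = Runs.run total ; inTime = ≤-trans (Runs.inTime total) (≤-reflexive collect) }
    where
    fitting : ∀ {p σ τ ρ} → Fits ρ p D → Runs (compile p) σ τ (time ρ p) → Runs (compile p) σ τ (factor p * D)
    fitting {p} {ρ = ρ} F (runs r t) = runs r (≤-trans t (time-fits ρ p 1≤D F))
    sizesRun : Runs (compile setupSizes) σᵢ σₛ (factor setupSizes * D)
    sizesRun = fitting {setupSizes} {ρ = regs σᵢ} fits-setupSizes
      (Execution.exec (only kR) (regs σᵢ) setupSizes _ σᵢ (λ _ _ → ≤-refl))
    powersRun : Runs (compile setupPowers) σₛ σ₀ (factor setupPowers * D)
    powersRun = fitting {setupPowers} {ρ = regs σₛ} fits-setupPowers
      (Execution.exec (λ x → (x ≡ᵇ stepsR) ∨ (x ≡ᵇ digitsR)) (regs σₛ) setupPowers _ σₛ (λ _ _ → ≤-refl))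
    mainRun : Runs (compile main) σ₀ (⟪ main ⟫ σ₀) (factor main * D)
    mainRun = fitting {main} {σ₀} {⟪ main ⟫ σ₀} {ρ₀ 0} fits-main
      (Execution.exec (_<ᵇ 9) (ρ₀ 0) main _ σ₀ (λ x x<9 → ≤-reflexive (regsMatch static x x<9)))
    answerRun : Runs (compile answer) (⟪ main ⟫ σ₀) (⟪ answer ⟫ (⟪ main ⟫ σ₀)) (factor answer * D)
    answerRun = fitting {answer} {⟪ main ⟫ σ₀} {⟪ answer ⟫ (⟪ main ⟫ σ₀)} {λ _ → 0} tt
      (Execution.exec (λ _ → false) (λ _ → 0) answer _ (⟪ main ⟫ σ₀) (λ _ ()))
    total = runs-seq sizesRun (runs-seq powersRun (runs-seq mainRun answerRun))
    collect : factor setupSizes * D + (factor setupPowers * D + (factor main * D + factor answer * D)) ≡ constant * D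
    collect = solve 5 (λ a b c d e → a :* e :+ (b :* e :+ (c :* e :+ d :* e)) := (a :+ (b :+ (c :+ d))) :* e) refl
      (factor setupSizes) (factor setupPowers) (factor main) (factor answer) D
      where open +-*-Solver

  fast : constant * D ≤ (k * ℓ ^ 2) ^ (k * ℓ) * (constant * 3 * (n + m))
  fast = begin
    constant * (M * (N * (N * V)))   ≡⟨ cong (constant *_) (solve 3 (λ a b c → a :* (b :* (b :* c)) := (a :* (b :* b)) :* c) refl M N V) ⟩
    constant * (M * (N * N) * V)     ≤⟨ *-monoʳ-≤ constant (*-monoˡ-≤ V (codes-bound k ℓ 1≤k 1≤ℓ)) ⟩
    constant * (3 * P * V)           ≡⟨ regroup constant P V ⟩
    P * (constant * 3 * V) ∎
    where
    open ≤-Reasoning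
    open +-*-Solver
    P = (k * ℓ ^ 2) ^ (k * ℓ)
    regroup : ∀ c p v → c * (3 * p * v) ≡ p * (c * 3 * v)
    regroup = solve 3 (λ c p v → c :* (con 3 :* p :* v) := p :* (c :* con 3 :* v)) refl

theorem3p13 : Σ[ p ∈ Program ] Σ[ c ∈ ℕ ]
    ((G : Graph) (s t : Graph.Vertex G) (k ℓ : ℕ) → 1 ≤ k → 1 ≤ ℓ →
    Σ[ σ ∈ State ] Σ[ T ∈ ℕ ]
    (⟨ p , input G s t k ℓ ⟩⇓⟨ σ , T ⟩
    × Answers σ (ShortPathPacking G s t k ℓ)
    × T ≤ (k * ℓ ^ 2) ^ (k * ℓ) * (c * (Graph.n G + Graph.m G))))
theorem3p13 = solver , constant * 3 , λ G s t k ℓ 1≤k 1≤ℓ →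
  let open Correctness G s t k ℓ 1≤k 1≤ℓ
      runs r t≤ = run
  in ⟪ answer ⟫ (⟪ main ⟫ σ₀) , _ , r , answers , ≤-trans t≤ fast
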